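{- Let $T$ be a tree with at least two vertices. Then $F_t(T) \ge F(T) + 1$, with equality if and only if $T \in \mathcal{H}$.
   Context: All graphs are finite, simple and undirected. Forcing process: given a graph $G$ and an initial set $S \subseteq V(G)$ of colored vertices, at each step a colored vertex that has exactly one non-colored neighbor forces (colors) that neighbor. $S$ is a forcing set if iterating this eventually colors all of $V(G)$; $F(G)$ is the minimum cardinality of a forcing set. A total forcing set (TF-set) is a forcing set $S$ such that $G[S]$ has no isolated vertex; $F_t(G)$ is the minimum cardinality of a TF-set. Contracting an edge $xy$ replaces $x,y$ by one new vertex adjacent to all former neighbors of $x$ or $y$. For a tree $T$ with at least two vertices, the trimmed tree $\mathrm{trim}(T)$ is obtained by iteratively contracting edges having one end of degree exactly $2$ and the other end of degree at most $2$, until no such edge remains. The family $\mathcal{H}$ consists of all trees $T$ of order $n \ge 2$ such that $T \cong P_n$ (the path on $n$ vertices) or $\mathrm{trim}(T) \cong K_{1,k}$ for some $k \ge 3$. -}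

module Defs where

open import Level using (0ℓ)
open import Data.Nat using (ℕ; zero; suc; _≤_; _+_)
open import Data.Nat.Properties using (1+n≢n)
open import Data.Fin using (Fin; zero; suc; toℕ)
import Data.Fin.Properties as FinP
import Data.Nat.Properties as NatP
open import Data.Fin.Subset using (Subset; _∈_; _∉_; ⁅_⁆; _∪_; ⊤; ∣_∣)
open import Data.Vec using (tabulate)
open import Data.List using (List; []; _∷_; _∷ʳ_; length)
open import Data.List.Relation.Unary.Linked using (Linked)
open import Data.List.Relation.Unary.Unique.Propositional using (Unique)
open import Data.Product using (Σ; ∃; ∃₂; _×_; _,_)
open import Data.Sum using (_⊎_; inj₁; inj₂; swap)
open import Relation.Nullary using (¬_; Dec; ⌊_⌋)
open import Relation.Nullary.Decidable using (_×-dec_; _⊎-dec_; ¬?)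
open import Relation.Binary using (Decidable)
open import Relation.Binary.PropositionalEquality using (_≡_; _≢_; refl; sym)
open import Relation.Binary.Construct.Closure.ReflexiveTransitive using (Star)
open import Function.Bundles using (_⇔_)

record Graph (n : ℕ) : Set₁ where
  field
    E      : Fin n → Fin n → Set
    E?     : Decidable E
    E-sym  : ∀ {u v} → E u v → E v u
    irrefl : ∀ {u} → ¬ E u u
open Graph public

module _ {n : ℕ} (G : Graph n) where

  N : Fin n → Subset n
  N v = tabulate (λ u → ⌊ E? G v u ⌋)

  deg : Fin n → ℕ
  deg v = ∣ N v ∣

  data Force : Subset n → Subset n → Set where
    force : ∀ {C} (v w : Fin n) → v ∈ C → E G v w → w ∉ C →
            (∀ w′ → E G v w′ → w′ ∉ C → w′ ≡ w) →
            Force C (C ∪ ⁅ w ⁆)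

  ForcingSet : Subset n → Set
  ForcingSet S = Star Force S ⊤

  TotalForcingSet : Subset n → Set
  TotalForcingSet S = ForcingSet S × (∀ v → v ∈ S → ∃ λ u → u ∈ S × E G v u)

  IsF : ℕ → Set
  IsF k = (∃ λ S → ForcingSet S × ∣ S ∣ ≡ k) × (∀ S → ForcingSet S → k ≤ ∣ S ∣)

  IsFt : ℕ → Set
  IsFt k = (∃ λ S → TotalForcingSet S × ∣ S ∣ ≡ k) × (∀ S → TotalForcingSet S → k ≤ ∣ S ∣)

  data Walk : Fin n → Fin n → Set where
    []  : ∀ {u} → Walk u u
    _∷_ : ∀ {u v w} → E G u v → Walk v w → Walk u w

  Connected : Set
  Connected = ∀ u v → Walk u v

  Cycle : Set
  Cycle = Σ (Fin n) λ v → Σ (Fin n) λ u → Σ (List (Fin n)) λ ws →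
          1 ≤ length ws × Unique ((v ∷ ws) ∷ʳ u) ×
          Linked (E G) ((v ∷ ws) ∷ʳ u) × E G u v

  IsTree : Set
  IsTree = Connected × ¬ Cycle

record Iso {n m : ℕ} (G : Graph n) (H : Graph m) : Set where
  field
    to      : Fin n → Fin m
    from    : Fin m → Fin n
    from-to : ∀ u → from (to u) ≡ u
    to-from : ∀ a → to (from a) ≡ a
    adj     : ∀ u v → E G u v ⇔ E H (to u) (to v)

record Contraction {m : ℕ} (G : Graph (suc m)) (x y : Fin (suc m)) (G′ : Graph m) : Set where
  field
    f     : Fin (suc m) → Fin m
    surj  : ∀ a → ∃ λ u → f u ≡ a
    merge : ∀ u v → f u ≡ f v ⇔ (u ≡ v ⊎ (u ≡ x × v ≡ y) ⊎ (u ≡ y × v ≡ x))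
    adj   : ∀ a b → a ≢ b →
            E G′ a b ⇔ (∃₂ λ u v → f u ≡ a × f v ≡ b × E G u v)

Eligible : {n : ℕ} → Graph n → Fin n → Fin n → Set
Eligible G x y = E G x y × deg G x ≡ 2 × deg G y ≤ 2

TrimStep : {m : ℕ} → Graph (suc m) → Graph m → Set
TrimStep G G′ = ∃₂ λ x y → Eligible G x y × Contraction G x y G′

data Trims : {n m : ℕ} → Graph n → Graph m → Set₁ where
  done : ∀ {n} {G : Graph n} → Trims G G
  step : ∀ {m k} {G : Graph (suc m)} {G′ : Graph m} {H : Graph k} →
         TrimStep G G′ → Trims G′ H → Trims G H

Trimmed : {n : ℕ} → Graph n → Set
Trimmed G = ∀ x y → ¬ Eligible G x y

TrimIso : {n k : ℕ} → Graph n → Graph k → Set₁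
TrimIso T H = Σ ℕ λ m → Σ (Graph m) λ T′ → Trims T T′ × Trimmed T′ × Iso T′ H

PathGraph : (n : ℕ) → Graph n
PathGraph n = record
  { E = λ i j → suc (toℕ i) ≡ toℕ j ⊎ suc (toℕ j) ≡ toℕ i
  ; E? = λ i j → (suc (toℕ i) NatP.≟ toℕ j) ⊎-dec (suc (toℕ j) NatP.≟ toℕ i)
  ; E-sym = swap
  ; irrefl = λ { (inj₁ p) → 1+n≢n p ; (inj₂ p) → 1+n≢n p }
  }

StarGraph : (k : ℕ) → Graph (suc k)
StarGraph k = record
  { E = λ i j → (i ≡ zero × j ≢ zero) ⊎ (j ≡ zero × i ≢ zero)
  ; E? = λ i j → ((i FinP.≟ zero) ×-dec ¬? (j FinP.≟ zero)) ⊎-dec ((j FinP.≟ zero) ×-dec ¬? (i FinP.≟ zero))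
  ; E-sym = swap
  ; irrefl = λ { (inj₁ (p , q)) → q p ; (inj₂ (p , q)) → q p }
  }

InH : {n : ℕ} → Graph n → Set₁
InH {n} T = Iso T (PathGraph n) ⊎ (Σ ℕ λ k → 3 ≤ k × TrimIso T (StarGraph k))

-- In a forest, the forcing sets are exactly the choices of one end for each path of a partition into
-- paths: if such a choice got stuck, following predecessors and unforced neighbours alternately would
-- give an endless walk without backtracking. An edge of G[S], S a TF-set, joins two forcing chains at
-- their ends, so F ≤ |S| - 1. If |S| = F + 1, no second join is possible; hence either |S| = 2 and F = 1,
-- which makes T a path, or G[S] is a star whose centre c forces, and the chains hung onto c span T as
-- a spider. Trees whose vertices other than c have degree at most 2 are the paths and the spiders, and
-- the latter are what trims to a star. Conversely, c with all but one of its neighbours is then a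
-- TF-set of size deg c (when deg c ≥ 2), while F ≥ deg c - 1 because c forces into one branch at most.
module Submission where

open import Defs
open import Data.Nat using (ℕ; zero; suc; _≤_; _<_; _+_; z≤n; s≤s)
import Data.Nat.Properties as ℕ
open import Data.Nat.Properties using (≤-trans; ≤-reflexive; ≤-antisym; ≤-pred; ≰⇒>; n≤1+n; 1+n≰n; m≤m+n; m≤n⇒m<n∨m≡n; suc-injective; +-suc)
open import Data.Fin using (Fin; zero; suc; toℕ; fromℕ<; punchIn; punchOut)
open import Data.Fin.Properties using (_≟_; any?; all?; ¬∀⟶∃¬; injective⇒≤; toℕ-injective; toℕ-fromℕ<; toℕ≤pred[n]; punchOut-injective; punchOut-cong; punchOut-punchIn; punchInᵢ≢i)
open import Data.Fin.Permutation using (transpose; _⟨$⟩ʳ_; _⟨$⟩ˡ_; inverseˡ; inverseʳ)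
open import Data.Fin.Subset using (Subset; inside; outside; _∈_; _∉_; _⊆_; ⁅_⁆; _∪_; _-_; ⊤; ∣_∣; Nonempty)
open import Data.Fin.Subset.Properties using (_∈?_; nonempty?; Empty-unique; ∣⊥∣≡0; ∣⊤∣≡n; ∣p∣≤n; ∣p∣≡n⇒p≡⊤; ∈⊤; x∈⁅x⁆; x∈⁅y⁆⇒x≡y; x≢y⇒x∉⁅y⁆; x∉⁅y⁆⇒x≢y; ∣⁅x⁆∣≡1; ⊆-antisym; p⊆q⇒∣p∣≤∣q∣; ∪-identityʳ; p⊆p∪q; q⊆p∪q; x∈p∪q⁻; p─⊥≡p; p─q⊆p; x∈p∧x≢y⇒x∈p-y)
open import Data.Vec using (_∷_; here; there)
open import Data.Vec.Properties using ([]=⇒lookup; lookup⇒[]=; lookup∘tabulate)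
open import Data.List using (List; []; _∷_; _∷ʳ_; length; lookup)
open import Data.List.Properties using (length-++-sucʳ; ++-identityʳ)
open import Data.List.Membership.Propositional using () renaming (_∈_ to _∈ˡ_)
open import Data.List.Membership.Propositional.Properties using (∈-lookup)
open import Data.List.Relation.Unary.All using (All; []; _∷_)
import Data.List.Relation.Unary.All as All
open import Data.List.Relation.Unary.AllPairs using ([]; _∷_)
open import Data.List.Relation.Unary.Any using (here; there)
open import Data.List.Relation.Unary.Linked using (Linked; [-]; _∷_)
open import Data.List.Relation.Unary.Unique.Propositional using (Unique)
open import Data.Product using (Σ; ∃; ∃₂; _×_; _,_; proj₁; proj₂)
open import Data.Sum using (_⊎_; inj₁; inj₂; swap)
import Data.Sum as Sum
open import Data.Empty using (⊥; ⊥-elim)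
open import Function using (_∘_; id; case_of_)
open import Function.Bundles using (_⇔_; mk⇔; Equivalence)
open import Relation.Nullary using (¬_; Dec; yes; no; contradiction; isYes)
open import Relation.Nullary.Decidable using (_×-dec_; _⊎-dec_; ¬?; _→-dec_; decidable-stable; dec-true; isYes≗does)
open import Relation.Binary.PropositionalEquality using (_≡_; _≢_; refl; sym; trans; cong; subst; subst₂)
open import Relation.Binary.Construct.Closure.ReflexiveTransitive using (Star; ε; _◅_; _◅◅_; reverse; map)

-- Elements and cardinalities of finite subsets.

∈∉⇒≢ : ∀ {n} {C : Subset n} {x y} → x ∈ C → y ∉ C → x ≢ y
∈∉⇒≢ x∈ y∉ refl = y∉ x∈

x∈p-y⇒x≢y : ∀ {n} {p : Subset n} {x y} → x ∈ p - y → x ≢ y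
x∈p-y⇒x≢y {p = inside ∷ p} {y = zero} () refl
x∈p-y⇒x≢y {p = outside ∷ p} {y = zero} () refl
x∈p-y⇒x≢y {p = _ ∷ p} {y = suc y} (there x∈) refl = x∈p-y⇒x≢y x∈ refl

x∈p-y⁻ : ∀ {n} {p : Subset n} {x y} → x ∈ p - y → x ∈ p × x ≢ y
x∈p-y⁻ {p = p} {y = y} x∈ = p─q⊆p p ⁅ y ⁆ x∈ , x∈p-y⇒x≢y x∈

1+∣p-x∣≡∣p∣ : ∀ {n} {p : Subset n} {x} → x ∈ p → suc ∣ p - x ∣ ≡ ∣ p ∣
1+∣p-x∣≡∣p∣ {p = inside ∷ p} here = cong (suc ∘ ∣_∣) (p─⊥≡p p)
1+∣p-x∣≡∣p∣ {p = inside ∷ p} (there x∈) = cong suc (1+∣p-x∣≡∣p∣ x∈)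
1+∣p-x∣≡∣p∣ {p = outside ∷ p} (there x∈) = 1+∣p-x∣≡∣p∣ x∈

∣p∪⁅x⁆∣≡1+∣p∣ : ∀ {n} {p : Subset n} {x} → x ∉ p → ∣ p ∪ ⁅ x ⁆ ∣ ≡ suc ∣ p ∣
∣p∪⁅x⁆∣≡1+∣p∣ {p = inside ∷ p} {zero} x∉ = contradiction here x∉
∣p∪⁅x⁆∣≡1+∣p∣ {p = outside ∷ p} {zero} x∉ = cong (suc ∘ ∣_∣) (∪-identityʳ p)
∣p∪⁅x⁆∣≡1+∣p∣ {p = inside ∷ p} {suc x} x∉ = cong suc (∣p∪⁅x⁆∣≡1+∣p∣ (x∉ ∘ there))
∣p∪⁅x⁆∣≡1+∣p∣ {p = outside ∷ p} {suc x} x∉ = ∣p∪⁅x⁆∣≡1+∣p∣ (x∉ ∘ there)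

x∈p∪y⁻ : ∀ {n} {p : Subset n} {x y} → x ∈ p ∪ ⁅ y ⁆ → x ∈ p ⊎ x ≡ y
x∈p∪y⁻ {p = p} {y = y} x∈ with x∈p∪q⁻ p ⁅ y ⁆ x∈
... | inj₁ x∈p = inj₁ x∈p
... | inj₂ x∈y = inj₂ (x∈⁅y⁆⇒x≡y y x∈y)

x∈p⇒x∈p∪y : ∀ {n} {p : Subset n} {x y} → x ∈ p → x ∈ p ∪ ⁅ y ⁆
x∈p⇒x∈p∪y {y = y} = p⊆p∪q ⁅ y ⁆

y∈p∪y : ∀ {n} {p : Subset n} {y} → y ∈ p ∪ ⁅ y ⁆
y∈p∪y {p = p} {y} = q⊆p∪q p ⁅ y ⁆ (x∈⁅x⁆ y)

∣p∪⁅y⁆∣≤1+∣p∣ : ∀ {n} (p : Subset n) y → ∣ p ∪ ⁅ y ⁆ ∣ ≤ suc ∣ p ∣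
∣p∪⁅y⁆∣≤1+∣p∣ p y with y ∈? p
... | no y∉ = ≤-reflexive (∣p∪⁅x⁆∣≡1+∣p∣ y∉)
... | yes y∈ = ≤-trans (p⊆q⇒∣p∣≤∣q∣ sub) (n≤1+n _)
  where
  sub : p ∪ ⁅ y ⁆ ⊆ p
  sub x∈ with x∈p∪y⁻ x∈
  ... | inj₁ x∈p = x∈p
  ... | inj₂ refl = y∈

empty⇒∣p∣≡0 : ∀ {n} {p : Subset n} → ¬ Nonempty p → ∣ p ∣ ≡ 0
empty⇒∣p∣≡0 {n} ¬ne = trans (cong ∣_∣ (Empty-unique ¬ne)) (∣⊥∣≡0 n)

0<∣p∣⇒nonempty : ∀ {n} {p : Subset n} → 1 ≤ ∣ p ∣ → Nonempty p
0<∣p∣⇒nonempty {n} {p} 1≤ with nonempty? p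
... | yes ne = ne
... | no ¬ne = contradiction (subst (1 ≤_) (empty⇒∣p∣≡0 ¬ne) 1≤) λ ()

-- A relation takes the place of an injective function, since partners are only known to exist for
-- members of `p`. Each round removes a matched pair, and injectivity of `Q` keeps the removed `b`
-- from being needed again.
∣p∣≤∣q∣-byInjection : ∀ {m n} (Q : Fin m → Fin n → Set) →
  (∀ {a a′ b} → Q a b → Q a′ b → a ≡ a′) →
  ∀ (p : Subset m) (q : Subset n) → (∀ {a} → a ∈ p → ∃ λ b → b ∈ q × Q a b) → ∣ p ∣ ≤ ∣ q ∣
∣p∣≤∣q∣-byInjection Q inj p q = go _ p q refl
  where
  go : ∀ k p q → ∣ p ∣ ≡ k → (∀ {a} → a ∈ p → ∃ λ b → b ∈ q × Q a b) → ∣ p ∣ ≤ ∣ q ∣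
  go zero p q eq f = subst (_≤ _) (sym eq) z≤n
  go (suc k) p q eq f with 0<∣p∣⇒nonempty (subst (1 ≤_) (sym eq) (s≤s z≤n))
  ... | a , a∈ with f a∈
  ...   | b , b∈ , Qab = subst (_≤ ∣ q ∣) (1+∣p-x∣≡∣p∣ a∈) (subst (suc ∣ p - a ∣ ≤_) (1+∣p-x∣≡∣p∣ b∈) (s≤s ih))
    where
    f′ : ∀ {c} → c ∈ p - a → ∃ λ d → d ∈ q - b × Q c d
    f′ c∈ with x∈p-y⁻ c∈
    ... | c∈p , c≢a with f c∈p
    ...   | d , d∈ , Qcd = d , x∈p∧x≢y⇒x∈p-y d∈ (λ { refl → c≢a (inj Qcd Qab) }) , Qcd
    ih : ∣ p - a ∣ ≤ ∣ q - b ∣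
    ih = go k (p - a) (q - b) (suc-injective (trans (1+∣p-x∣≡∣p∣ a∈) eq)) f′

∣p∣≤2 : ∀ {n} (p : Subset n) →
  (∀ {a b c} → a ∈ p → b ∈ p → c ∈ p → a ≡ b ⊎ b ≡ c ⊎ a ≡ c) → ∣ p ∣ ≤ 2
∣p∣≤2 p h with nonempty? p
... | no ¬ne = subst (_≤ 2) (sym (empty⇒∣p∣≡0 ¬ne)) z≤n
... | yes (a , a∈) with nonempty? (p - a)
...   | no ¬ne = subst (_≤ 2) (1+∣p-x∣≡∣p∣ a∈) (s≤s (subst (_≤ 1) (sym (empty⇒∣p∣≡0 ¬ne)) z≤n))
...   | yes (b , b∈) = subst (_≤ 2) (1+∣p-x∣≡∣p∣ a∈) (s≤s (subst (_≤ 1) (1+∣p-x∣≡∣p∣ b∈) (s≤s (≤-reflexive (empty⇒∣p∣≡0 empty)))))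
  where
  empty : ¬ Nonempty (p - a - b)
  empty (c , c∈) with x∈p-y⁻ c∈
  ... | c∈′ , c≢b with x∈p-y⁻ b∈ | x∈p-y⁻ c∈′
  ...   | b∈p , b≢a | c∈p , c≢a with h a∈ b∈p c∈p
  ...     | inj₁ a≡b = b≢a (sym a≡b)
  ...     | inj₂ (inj₁ b≡c) = c≢b (sym b≡c)
  ...     | inj₂ (inj₂ a≡c) = c≢a (sym a≡c)

2≤∣p∣ : ∀ {n} {p : Subset n} {a b} → a ∈ p → b ∈ p → a ≢ b → 2 ≤ ∣ p ∣
2≤∣p∣ a∈ b∈ a≢b = subst (2 ≤_) (1+∣p-x∣≡∣p∣ a∈) (s≤s (subst (1 ≤_) (1+∣p-x∣≡∣p∣ (x∈p∧x≢y⇒x∈p-y b∈ (a≢b ∘ sym))) (s≤s z≤n)))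

∣p∣≤2⇒ : ∀ {n} {p : Subset n} → ∣ p ∣ ≤ 2 →
  ∀ {a b c} → a ∈ p → b ∈ p → c ∈ p → a ≡ b ⊎ b ≡ c ⊎ a ≡ c
∣p∣≤2⇒ {p = p} ≤2 {a} {b} {c} a∈ b∈ c∈ with a ≟ b | b ≟ c | a ≟ c
... | yes e | _ | _ = inj₁ e
... | _ | yes e | _ = inj₂ (inj₁ e)
... | _ | _ | yes e = inj₂ (inj₂ e)
... | no a≢b | no b≢c | no a≢c = contradiction (subst (_≤ 2) (sym (1+∣p-x∣≡∣p∣ c∈)) ≤2) λ { (s≤s le) → 1+n≰n (≤-trans
        (2≤∣p∣ (x∈p∧x≢y⇒x∈p-y a∈ a≢c) (x∈p∧x≢y⇒x∈p-y b∈ b≢c) a≢b) le) }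

-- Neighbourhoods and the forcing process.

module _ {n : ℕ} (G : Graph n) where

  ∈N⇒E : ∀ {v u} → u ∈ N G v → E G v u
  ∈N⇒E {v} {u} u∈ with E? G v u | trans (sym (lookup∘tabulate (λ x → isYes (E? G v x)) u)) ([]=⇒lookup u∈)
  ... | yes e | _ = e
  ... | no _ | ()

  E⇒∈N : ∀ {v u} → E G v u → u ∈ N G v
  E⇒∈N {v} {u} e = lookup⇒[]= u (N G v) (trans (lookup∘tabulate _ u) (trans (isYes≗does (E? G v u)) (dec-true (E? G v u) e)))

  -- Every force adds a vertex, so an invariant that always permits another force leads to `⊤`. The
  -- fuel `m` bounds the number of vertices still uncoloured.
  progress⇒forcing : (P : Subset n → Set) →
    (∀ {C z} → P C → z ∉ C → ∃ λ C′ → Force G C C′ × P C′) →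
    ∀ {S} → P S → ForcingSet G S
  progress⇒forcing P next {S} = go n S (m≤m+n n _)
    where
    go : ∀ m C → n ≤ m + ∣ C ∣ → P C → ForcingSet G C
    go m C le PC with all? (_∈? C)
    ... | yes all = subst (Star (Force G) C) (⊆-antisym (λ _ → ∈⊤) (λ {x} _ → all x)) ε
    ... | no ¬all with ¬∀⟶∃¬ n _ (_∈? C) ¬all
    ...   | z , z∉ with next PC z∉
    ...     | _ , fc@(force v w v∈ e w∉ u) , PC′ with m
    ...       | zero = contradiction (subst (z ∈_) (sym (∣p∣≡n⇒p≡⊤ {p = C} (≤-antisym (∣p∣≤n C) le))) ∈⊤) z∉
    ...       | suc m = fc ◅ go m _ (subst (n ≤_) (trans (sym (+-suc m _)) (cong (m +_) (sym (∣p∪⁅x⁆∣≡1+∣p∣ w∉)))) le) PC′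

  forcing-nonempty : 1 ≤ n → ∀ {S} → ForcingSet G S → Nonempty S
  forcing-nonempty 1≤n ε = 0<∣p∣⇒nonempty (subst (1 ≤_) (sym (∣⊤∣≡n n)) 1≤n)
  forcing-nonempty 1≤n (force v w v∈ e w∉ u ◅ _) = v , v∈

-- Simple paths, acyclicity and endless walks.

-- The list index holds all vertices of the simple path but the last.
data Path {n : ℕ} (R : Fin n → Fin n → Set) : Fin n → Fin n → List (Fin n) → Set where
  nil  : ∀ {y} → Path R y y []
  cons : ∀ {x z y l} → R x z → All (x ≢_) (l ∷ʳ y) → Path R z y l → Path R x y (x ∷ l)

module _ {n : ℕ} {R : Fin n → Fin n → Set} where

  path-unique : ∀ {x y l} → Path R x y l → Unique (l ∷ʳ y)
  path-unique nil = [] ∷ []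
  path-unique (cons _ x∉ p) = x∉ ∷ path-unique p

  path-linked : ∀ {x y l} → Path R x y l → Linked R (l ∷ʳ y)
  path-linked nil = [-]
  path-linked (cons r _ nil) = r ∷ [-]
  path-linked (cons r _ p@(cons _ _ _)) = r ∷ path-linked p

  path-suffix : ∀ {x y z l} → Path R x y l → z ∈ˡ l ∷ʳ y → ∃ (Path R z y)
  path-suffix nil (here refl) = _ , nil
  path-suffix p@(cons _ _ _) (here refl) = _ , p
  path-suffix (cons _ _ p) (there z∈) = path-suffix p z∈

  -- The last component says that the prefix visits no new vertex, in the form in which freshness of
  -- a vertex is passed on to it.
  path-prefix : ∀ {x y z l} → Path R x y l → z ∈ˡ l ∷ʳ y →
    ∃ λ l′ → Path R x z l′ × (∀ {P : Fin n → Set} → All P (l ∷ʳ y) → All P (l′ ∷ʳ z))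
  path-prefix nil (here refl) = _ , nil , id
  path-prefix (cons _ _ _) (here refl) = _ , nil , λ { (px ∷ _) → px ∷ [] }
  path-prefix (cons r x∉ p) (there z∈) with path-prefix p z∈
  ... | l′ , p′ , sub = _ , cons r (sub x∉) p′ , λ { (px ∷ pxs) → px ∷ sub pxs }

  open import Data.List.Membership.DecPropositional (_≟_ {n}) using () renaming (_∈?_ to _∈ˡ?_)

  erase-loops : ∀ {x y} → Star R x y → ∃ (Path R x y)
  erase-loops ε = _ , nil
  erase-loops {x} {y} (r ◅ rs) with erase-loops rs
  ... | l , p with x ∈ˡ? l ∷ʳ y
  ...   | yes x∈ = path-suffix p x∈
  ...   | no x∉ = _ , cons r (∉⇒All≢ x∉) p
    where
    ∉⇒All≢ : ∀ {l} → ¬ x ∈ˡ l → All (x ≢_) l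
    ∉⇒All≢ x∉ = All.tabulate λ { z∈ refl → x∉ z∈ }

path-map : ∀ {n} {R R′ : Fin n → Fin n → Set} → (∀ {a b} → R a b → R′ a b) →
  ∀ {x y l} → Path R x y l → Path R′ x y l
path-map f nil = nil
path-map f (cons r x∉ p) = cons (f r) x∉ (path-map f p)

unique-lookup-injective : ∀ {n} {l : List (Fin n)} → Unique l → ∀ {i j} → lookup l i ≡ lookup l j → i ≡ j
unique-lookup-injective (x∉ ∷ u) {zero} {zero} eq = refl
unique-lookup-injective (x∉ ∷ u) {zero} {suc j} eq = contradiction eq (All.lookup x∉ (∈-lookup j))
unique-lookup-injective (x∉ ∷ u) {suc i} {zero} eq = contradiction (sym eq) (All.lookup x∉ (∈-lookup i))
unique-lookup-injective (x∉ ∷ u) {suc i} {suc j} eq = cong suc (unique-lookup-injective u eq)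

unique⇒length≤ : ∀ {n} {l : List (Fin n)} → Unique l → length l ≤ n
unique⇒length≤ u = injective⇒≤ (unique-lookup-injective u)

-- Acyclicity in the form "every edge is a bridge".
Acyclic : ∀ {n} → Graph n → Set₁
Acyclic {n} G = (R : Fin n → Fin n → Set) → (∀ {a b} → R a b → E G a b) →
  ∀ {x y} → E G x y → Star R x y → ¬ ¬ R x y

module _ {n : ℕ} (G : Graph n) where

  path⇒cycle : ∀ {x y z l} → Path (E G) x y (x ∷ z ∷ l) → E G y x → Cycle G
  path⇒cycle p e = _ , _ , _ , s≤s z≤n , path-unique p , path-linked p , e

  -- With its loops erased, a walk between the ends of an edge is either a single step or a path
  -- that the edge closes to a cycle.
  acyclic : ¬ Cycle G → Acyclic G
  acyclic ¬cyc R R⊆E {x} {y} e rs ¬r with erase-loops rs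
  ... | _ , nil = irrefl G e
  ... | _ , cons r _ nil = ¬r r
  ... | _ , p@(cons _ _ (cons _ _ _)) = ¬cyc (path⇒cycle (path-map R⊆E p) (E-sym G e))

  -- Otherwise the walk visits more vertices than there are, or closes a cycle at its first repetition.
  no-endless-walk : ¬ Cycle G → (W : Fin n → Fin n → Set) →
    (∀ {a b} → W a b → E G a b) →
    (∀ {a b} → W a b → ∃ λ d → d ≢ a × W b d) → ∀ {a b} → ¬ W a b
  no-endless-walk ¬cyc W W⊆E next {a} {b} w =
    go n nil (E-sym G (W⊆E w)) ((λ { refl → irrefl G (W⊆E w) }) ∷ []) w (m≤m+n n _)
    where
    open import Data.List.Membership.DecPropositional (_≟_ {n}) using () renaming (_∈?_ to _∈ˡ?_)

    -- `p` is the trail in reverse, from the previous vertex `a` back to the start `z`; `b` is the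
    -- current vertex.
    go : ∀ m {a b z l} → Path (E G) a z l → E G b a → All (b ≢_) (l ∷ʳ z) → W a b →
      n ≤ m + length (b ∷ l) → ⊥
    go m {a} {b} {z} {l} p e b∉ w le with next w
    ... | d , d≢a , w′ with d ∈ˡ? l ∷ʳ z
    ...   | yes d∈ with path-prefix p d∈
    -- An empty prefix means a return to the vertex just left, the one repetition that closes no
    -- cycle.
    ...     | _ , nil , _ = d≢a refl
    ...     | _ , p′@(cons _ _ _) , sub = ¬cyc (path⇒cycle (cons e (sub b∉) p′) (E-sym G (W⊆E w′)))
    -- The list `b ∷ l` omits the last vertex `z`, so once its length reaches `n` there are more
    -- than `n` distinct vertices on the trail.
    go zero {b = b} {z} {l} p e b∉ w le | d , d≢a , w′ | no d∉ = 1+n≰n (≤-trans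
      (subst (_≤ n) (trans (length-++-sucʳ (b ∷ l) z []) (cong (suc ∘ length) (++-identityʳ (b ∷ l))))
        (unique⇒length≤ (path-unique (cons {R = E G} e b∉ p)))) le)
    go (suc m) {l = l} p e b∉ w le | d , d≢a , w′ | no d∉ =
      go m (cons e b∉ p) (E-sym G (W⊆E w′))
        ((λ { refl → irrefl G (W⊆E w′) }) ∷ All.tabulate (λ { z∈ refl → d∉ z∈ })) w′
        (subst (n ≤_) (sym (+-suc m _)) le)

-- Path covers, their growth under forcing, and the forcing sets they yield.

infixl 9 _[_↦_]
_[_↦_] : ∀ {n} {A : Set} → (Fin n → A) → Fin n → A → Fin n → A
(p [ w ↦ v ]) x with x ≟ w
... | yes _ = v
... | no _ = p x

module _ {n : ℕ} {A : Set} (p : Fin n → A) (w : Fin n) (v : A) where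

  update-same : (p [ w ↦ v ]) w ≡ v
  update-same with w ≟ w
  ... | yes _ = refl
  ... | no w≢w = contradiction refl w≢w

  update-other : ∀ {x} → x ≢ w → (p [ w ↦ v ]) x ≡ p x
  update-other {x} x≢w with x ≟ w
  ... | yes x≡w = contradiction x≡w x≢w
  ... | no _ = refl

module _ {n : ℕ} (G : Graph n) where

  -- A partition of C into directed paths of G with starting vertices A,
  -- where p maps every other vertex of C to its predecessor.
  record Cover (C A : Subset n) (p : Fin n → Fin n) : Set where
    field
      sources    : A ⊆ C
      pred-∈     : ∀ {x} → x ∈ C → x ∉ A → p x ∈ C
      pred-edge  : ∀ {x} → x ∈ C → x ∉ A → E G (p x) x
      pred-inj   : ∀ {x y} → x ∈ C → x ∉ A → y ∈ C → y ∉ A → p x ≡ p y → x ≡ y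
      no-2-cycle : ∀ {x} → x ∈ C → x ∉ A → p x ∉ A → p (p x) ≢ x
  open Cover

  -- Whichever vertex forces next, it is an end of its path, so that the path can be prolonged.
  Extendable : (C A : Subset n) (p : Fin n → Fin n) → Set
  Extendable C A p = ∀ {v w} → v ∈ C → w ∉ C → E G v w → v ∈ A ⊎ (∀ {x} → x ∈ C → x ∉ A → p x ≢ v)

  module _ {C A : Subset n} {p : Fin n → Fin n} (cov : Cover C A p) {v w : Fin n}
           (v∈ : v ∈ C) (e : E G v w) (w∉ : w ∉ C) where

    module _ (childless : ∀ {x} → x ∈ C → x ∉ A → p x ≢ v) where

      private
        p′ = p [ w ↦ v ]
        same : p′ w ≡ v
        same = update-same p w v
        other : ∀ {x} → x ≢ w → p′ x ≡ p x
        other = update-other p w v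
        p′∈ : ∀ {x} → x ∈ C → p′ x ≡ p x
        p′∈ x∈ = other (∈∉⇒≢ x∈ w∉)

      -- Here `v` is the last vertex of its path, and `w` becomes its successor.
      append-cover : Cover (C ∪ ⁅ w ⁆) A p′
      append-cover .sources = x∈p⇒x∈p∪y ∘ sources cov
      append-cover .pred-∈ x∈ x∉ with x∈p∪y⁻ x∈
      ... | inj₁ x∈C = x∈p⇒x∈p∪y (subst (_∈ C) (sym (p′∈ x∈C)) (pred-∈ cov x∈C x∉))
      ... | inj₂ refl = x∈p⇒x∈p∪y (subst (_∈ C) (sym same) v∈)
      append-cover .pred-edge {x} x∈ x∉ with x∈p∪y⁻ x∈
      ... | inj₁ x∈C = subst (λ y → E G y x) (sym (p′∈ x∈C)) (pred-edge cov x∈C x∉)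
      ... | inj₂ refl = subst (λ y → E G y x) (sym same) e
      append-cover .pred-inj x∈ x∉ y∈ y∉ eq with x∈p∪y⁻ x∈ | x∈p∪y⁻ y∈
      ... | inj₁ x∈C | inj₁ y∈C = pred-inj cov x∈C x∉ y∈C y∉ (trans (sym (p′∈ x∈C)) (trans eq (p′∈ y∈C)))
      ... | inj₁ x∈C | inj₂ refl = contradiction (trans (sym (p′∈ x∈C)) (trans eq same)) (childless x∈C x∉)
      ... | inj₂ refl | inj₁ y∈C = contradiction (trans (sym (p′∈ y∈C)) (trans (sym eq) same)) (childless y∈C y∉)
      ... | inj₂ refl | inj₂ refl = refl
      append-cover .no-2-cycle {x} x∈ x∉ px∉ eq with x∈p∪y⁻ x∈
      ... | inj₁ x∈C = no-2-cycle cov x∈C x∉ (subst (_∉ A) (p′∈ x∈C) px∉)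
                         (trans (sym (p′∈ (pred-∈ cov x∈C x∉))) (trans (cong p′ (sym (p′∈ x∈C))) eq))
      ... | inj₂ refl = ∈∉⇒≢ (pred-∈ cov v∈ (subst (_∉ A) same px∉)) w∉
                          (trans (sym (p′∈ v∈)) (trans (cong p′ (sym same)) eq))

      -- `w` is an end of the prolonged path. The vertex `v` may become interior, because by `only`
      -- none of its neighbours is left uncoloured.
      append-extendable : (∀ w′ → E G v w′ → w′ ∉ C → w′ ≡ w) →
        Extendable C A p → Extendable (C ∪ ⁅ w ⁆) A p′
      append-extendable only ext {a} {b} a∈ b∉ ab = helper (x∈p∪y⁻ a∈)
        where
        helper : a ∈ C ⊎ a ≡ w → a ∈ A ⊎ (∀ {x} → x ∈ C ∪ ⁅ w ⁆ → x ∉ A → p′ x ≢ a)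
        helper (inj₂ refl) = inj₂ nochild
          where
          nochild : ∀ {x} → x ∈ C ∪ ⁅ w ⁆ → x ∉ A → p′ x ≢ a
          nochild x∈ x∉ eq with x∈p∪y⁻ x∈
          ... | inj₁ x∈C = ∈∉⇒≢ (pred-∈ cov x∈C x∉) w∉ (trans (sym (p′∈ x∈C)) eq)
          ... | inj₂ refl = ∈∉⇒≢ v∈ w∉ (trans (sym same) eq)
        helper (inj₁ a∈C) with ext a∈C (b∉ ∘ x∈p⇒x∈p∪y) ab
        ... | inj₁ a∈A = inj₁ a∈A
        ... | inj₂ ch = inj₂ nochild
          where
          nochild : ∀ {x} → x ∈ C ∪ ⁅ w ⁆ → x ∉ A → p′ x ≢ a
          nochild x∈ x∉ eq with x∈p∪y⁻ x∈
          ... | inj₁ x∈C = ch x∈C x∉ (trans (sym (p′∈ x∈C)) eq)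
          ... | inj₂ refl with trans (sym same) eq
          ...   | refl = b∉ (subst (_∈ C ∪ ⁅ w ⁆) (sym (only b ab (b∉ ∘ x∈p⇒x∈p∪y))) (y∈p∪y {p = C}))

    module _ (v∈A : v ∈ A) where

      private
        A′ = (A - v) ∪ ⁅ w ⁆
        p′ = p [ v ↦ w ]
        same : p′ v ≡ w
        same = update-same p v w
        other : ∀ {x} → x ≢ v → p′ x ≡ p x
        other = update-other p v w

        w∈A′ : w ∈ A′
        w∈A′ = y∈p∪y {p = A - v}

        ∈A′ : ∀ {x} → x ∈ A → x ≢ v → x ∈ A′
        ∈A′ x∈ x≢v = x∈p⇒x∈p∪y (x∈p∧x≢y⇒x∈p-y x∈ x≢v)

        split : ∀ {x} → x ∈ C ∪ ⁅ w ⁆ → x ∉ A′ → x ≡ v ⊎ (x ≢ v × x ∈ C × x ∉ A)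
        split {x} x∈ x∉ with x ≟ v
        ... | yes x≡v = inj₁ x≡v
        ... | no x≢v with x∈p∪y⁻ x∈
        ...   | inj₁ x∈C = inj₂ (x≢v , x∈C , λ x∈A → x∉ (∈A′ x∈A x≢v))
        ...   | inj₂ refl = contradiction w∈A′ x∉

      -- Here `v` is the first vertex of its path, which grows backwards: `w` becomes the
      -- predecessor of `v` and replaces it as starting vertex, against the direction of the force.
      prepend-cover : Cover (C ∪ ⁅ w ⁆) A′ p′
      prepend-cover .sources x∈ with x∈p∪y⁻ x∈
      ... | inj₁ x∈A = x∈p⇒x∈p∪y (sources cov (proj₁ (x∈p-y⁻ x∈A)))
      ... | inj₂ refl = y∈p∪y {p = C}
      prepend-cover .pred-∈ x∈ x∉ with split x∈ x∉
      ... | inj₁ refl = subst (_∈ C ∪ ⁅ w ⁆) (sym same) (y∈p∪y {p = C})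
      ... | inj₂ (x≢v , x∈C , x∉A) = subst (_∈ C ∪ ⁅ w ⁆) (sym (other x≢v)) (x∈p⇒x∈p∪y (pred-∈ cov x∈C x∉A))
      prepend-cover .pred-edge {x} x∈ x∉ with split x∈ x∉
      ... | inj₁ refl = subst (λ y → E G y x) (sym same) (E-sym G e)
      ... | inj₂ (x≢v , x∈C , x∉A) = subst (λ y → E G y x) (sym (other x≢v)) (pred-edge cov x∈C x∉A)
      prepend-cover .pred-inj x∈ x∉ y∈ y∉ eq with split x∈ x∉ | split y∈ y∉
      ... | inj₁ refl | inj₁ refl = refl
      ... | inj₁ refl | inj₂ (y≢v , y∈C , y∉A) =
        contradiction (trans (sym (other y≢v)) (trans (sym eq) same)) (∈∉⇒≢ (pred-∈ cov y∈C y∉A) w∉)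
      ... | inj₂ (x≢v , x∈C , x∉A) | inj₁ refl =
        contradiction (trans (sym (other x≢v)) (trans eq same)) (∈∉⇒≢ (pred-∈ cov x∈C x∉A) w∉)
      ... | inj₂ (x≢v , x∈C , x∉A) | inj₂ (y≢v , y∈C , y∉A) =
        pred-inj cov x∈C x∉A y∈C y∉A (trans (sym (other x≢v)) (trans eq (other y≢v)))
      prepend-cover .no-2-cycle {x} x∈ x∉ px∉ eq with split x∈ x∉
      ... | inj₁ refl = subst (_∉ A′) same px∉ w∈A′
      ... | inj₂ (x≢v , x∈C , x∉A) with p x ≟ v
      ...   | yes px≡v = ∈∉⇒≢ x∈C w∉ (trans (sym eq) (trans (cong p′ (trans (other x≢v) px≡v)) same))
      ...   | no px≢v = no-2-cycle cov x∈C x∉A (λ px∈ → px∉ (subst (_∈ A′) (sym (other x≢v)) (∈A′ px∈ px≢v)))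
                          (trans (sym (other px≢v)) (trans (cong p′ (sym (other x≢v))) eq))

      prepend-extendable : (∀ w′ → E G v w′ → w′ ∉ C → w′ ≡ w) →
        Extendable C A p → Extendable (C ∪ ⁅ w ⁆) A′ p′
      prepend-extendable only ext {a} {b} a∈ b∉ ab = helper (x∈p∪y⁻ a∈)
        where
        helper : a ∈ C ⊎ a ≡ w → a ∈ A′ ⊎ (∀ {x} → x ∈ C ∪ ⁅ w ⁆ → x ∉ A′ → p′ x ≢ a)
        helper (inj₂ refl) = inj₁ w∈A′
        helper (inj₁ a∈C) with ext a∈C (b∉ ∘ x∈p⇒x∈p∪y) ab
        ... | inj₁ a∈A = inj₁ (∈A′ a∈A λ { refl → b∉ (subst (_∈ C ∪ ⁅ w ⁆) (sym (only b ab (b∉ ∘ x∈p⇒x∈p∪y))) (y∈p∪y {p = C})) })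
        ... | inj₂ ch = inj₂ nochild
          where
          nochild : ∀ {x} → x ∈ C ∪ ⁅ w ⁆ → x ∉ A′ → p′ x ≢ a
          nochild x∈ x∉ eq with split x∈ x∉
          ... | inj₁ refl = ∈∉⇒≢ a∈C w∉ (trans (sym eq) same)
          ... | inj₂ (x≢v , x∈C , x∉A) = ch x∈C x∉A (trans (sym (other x≢v)) eq)

      prepend-size : ∣ A′ ∣ ≡ ∣ A ∣
      prepend-size = trans (∣p∪⁅x⁆∣≡1+∣p∣ (w∉ ∘ sources cov ∘ proj₁ ∘ x∈p-y⁻)) (1+∣p-x∣≡∣p∣ v∈A)

  -- The forces are replayed on the cover. Each prolongs one path at one of its ends, so the number
  -- of paths stays the same.
  extend-cover : ∀ {C A p} → Star (Force G) C ⊤ → Cover C A p → Extendable C A p →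
    ∃₂ λ A′ p′ → Cover ⊤ A′ p′ × ∣ A′ ∣ ≡ ∣ A ∣
  extend-cover ε cov ext = _ , _ , cov , refl
  extend-cover (force v w v∈ e w∉ only ◅ fs) cov ext with ext v∈ w∉ e
  ... | inj₂ ch = extend-cover fs (append-cover cov v∈ e w∉ ch) (append-extendable cov v∈ e w∉ ch only ext)
  ... | inj₁ v∈A with extend-cover fs (prepend-cover cov v∈ e w∉ v∈A) (prepend-extendable cov v∈ e w∉ v∈A only ext)
  ...   | A′ , p′ , cov′ , eq = A′ , p′ , cov′ , trans eq (prepend-size cov v∈ e w∉ v∈A)

  module _ (¬cyc : ¬ Cycle G) where

    -- If forcing is stuck at C, then walk as follows: from an uncoloured vertex to its predecessor,
    -- and from a coloured vertex with uncoloured successor to another uncoloured neighbour.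
    cover⇒forcing : ∀ {A p} → Cover ⊤ A p → ForcingSet G A
    cover⇒forcing {A} {p} cov = progress⇒forcing G (A ⊆_) next id
      where
      module _ {C : Subset n} (A⊆C : A ⊆ C) where
        Forces : Fin n → Fin n → Set
        Forces v w = v ∈ C × E G v w × w ∉ C × (∀ w′ → E G v w′ → w′ ∉ C → w′ ≡ w)

        Forces? : ∀ v w → Dec (Forces v w)
        Forces? v w = v ∈? C ×-dec E? G v w ×-dec ¬? (w ∈? C) ×-dec
          all? (λ w′ → E? G v w′ →-dec (¬? (w′ ∈? C) →-dec w′ ≟ w))

        module _ (stuck : ¬ ∃₂ Forces) where
          another : ∀ {v w} → v ∈ C → E G v w → w ∉ C → ∃ λ w′ → w′ ≢ w × E G v w′ × w′ ∉ C
          another {v} {w} v∈ e w∉ with any? (λ w′ → ¬? (w′ ≟ w) ×-dec E? G v w′ ×-dec ¬? (w′ ∈? C))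
          ... | yes found = found
          ... | no ¬found = contradiction (v , w , v∈ , e , w∉ , λ w′ e′ w′∉ →
                  decidable-stable (w′ ≟ w) λ w′≢w → ¬found (w′ , w′≢w , e′ , w′∉)) stuck

          Walks : Fin n → Fin n → Set
          Walks a b = E G a b × (b ∉ C × p b ≢ a ⊎ a ∉ C × b ∈ C × p a ≡ b)

          to-pred : ∀ {b} → b ∉ C → Walks b (p b)
          to-pred {b} b∉ with p b ∈? C
          ... | yes pb∈ = E-sym G (pred-edge cov ∈⊤ (b∉ ∘ A⊆C)) , inj₂ (b∉ , pb∈ , refl)
          -- Two uncoloured vertices in a row: `no-2-cycle` keeps the walk from turning back. Longer
          -- cycles of `p` are excluded by acyclicity of `G`.
          ... | no pb∉ = E-sym G (pred-edge cov ∈⊤ (b∉ ∘ A⊆C)) , inj₁ (pb∉ , no-2-cycle cov ∈⊤ (b∉ ∘ A⊆C) (pb∉ ∘ A⊆C))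

          continue : ∀ {a b} → Walks a b → ∃ λ d → d ≢ a × Walks b d
          continue (e , inj₁ (b∉ , pb≢a)) = _ , pb≢a , to-pred b∉
          continue (e , inj₂ (a∉ , b∈ , pa≡b)) with another b∈ (E-sym G e) a∉
          -- The walk came from the successor `a` of `b`, and successors are unique, so `d` is
          -- entered from a vertex other than its predecessor.
          ... | d , d≢a , e′ , d∉ = d , d≢a , e′ , inj₁ (d∉ , λ pd≡b →
                  d≢a (pred-inj cov ∈⊤ (d∉ ∘ A⊆C) ∈⊤ (a∉ ∘ A⊆C) (trans pd≡b (sym pa≡b))))

      next : ∀ {C z} → A ⊆ C → z ∉ C → ∃ λ C′ → Force G C C′ × A ⊆ C′
      next {C} A⊆C z∉ with any? (λ v → any? (Forces? A⊆C v))
      ... | yes (v , w , v∈ , e , w∉ , only) = _ , force v w v∈ e w∉ only , x∈p⇒x∈p∪y ∘ A⊆C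
      ... | no stuck = contradiction (to-pred A⊆C stuck z∉)
              (no-endless-walk G ¬cyc (Walks A⊆C stuck) proj₁ (continue A⊆C stuck))

    -- Initially each member of `S` is a path by itself. The edge joins two of them into the path
    -- `u`, `v`, both of whose vertices are ends, so the forces can still be replayed, with one path
    -- fewer.
    join-edge : ∀ {S} → ForcingSet G S → ∀ {u v} → u ∈ S → v ∈ S → E G u v →
      ∃ λ A → ForcingSet G A × suc ∣ A ∣ ≡ ∣ S ∣
    join-edge {S} fs {u} {v} u∈ v∈ e with extend-cover fs cov ext
      where
      only-v : ∀ {x} → x ∈ S → x ∉ S - v → x ≡ v
      only-v {x} x∈ x∉ = decidable-stable (x ≟ v) λ x≢v → x∉ (x∈p∧x≢y⇒x∈p-y x∈ x≢v)

      u≢v : u ≢ v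
      u≢v refl = irrefl G e

      cov : Cover S (S - v) (λ _ → u)
      cov .sources = proj₁ ∘ x∈p-y⁻
      cov .pred-∈ _ _ = u∈
      cov .pred-edge x∈ x∉ with only-v x∈ x∉
      ... | refl = e
      cov .pred-inj x∈ x∉ y∈ y∉ _ = trans (only-v x∈ x∉) (sym (only-v y∈ y∉))
      cov .no-2-cycle x∈ x∉ u∉ _ = u∉ (x∈p∧x≢y⇒x∈p-y u∈ u≢v)

      ext : Extendable S (S - v) (λ _ → u)
      ext {y} y∈ _ _ with y ≟ v
      ... | yes refl = inj₂ λ _ _ → u≢v
      ... | no y≢v = inj₁ (x∈p∧x≢y⇒x∈p-y y∈ y≢v)
    ... | A′ , _ , cov′ , eq = A′ , cover⇒forcing cov′ , trans (cong suc eq) (1+∣p-x∣≡∣p∣ v∈)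

    -- If `u′` differs from `v`, the edges are disjoint and form two paths. If they coincide, the
    -- single path `u`, `v`, `v′` has the interior vertex `v`, which never has to force as all its
    -- neighbours lie in `S`.
    join-edges : ∀ {S} → ForcingSet G S → ∀ {u v u′ v′} → u ∈ S → v ∈ S → E G u v →
      u′ ∈ S → v′ ∈ S → E G u′ v′ → u ≢ u′ → v ≢ v′ → u ≢ v′ →
      u′ ≢ v ⊎ (∀ w → E G v w → w ∈ S) →
      ∃ λ A → ForcingSet G A × suc (suc ∣ A ∣) ≡ ∣ S ∣
    join-edges {S} fs {u} {v} {u′} {v′} u∈ v∈ e u′∈ v′∈ e′ u≢u′ v≢v′ u≢v′ alternative with extend-cover fs cov (ext alternative)
      where
      p : Fin n → Fin n
      -- The default `u′` is meant for `v′`; the other members of `S` except `v` are starting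
      -- vertices and have no predecessor.
      p = (λ _ → u′) [ v ↦ u ]

      pv : p v ≡ u
      pv = update-same _ v u
      pv′ : p v′ ≡ u′
      pv′ = update-other _ v u (v≢v′ ∘ sym)

      split : ∀ {x} → x ∈ S → x ∉ S - v - v′ → x ≡ v ⊎ x ≡ v′
      split {x} x∈ x∉ with x ≟ v
      ... | yes x≡v = inj₁ x≡v
      ... | no x≢v = inj₂ (decidable-stable (x ≟ v′) λ x≢v′ → x∉ (x∈p∧x≢y⇒x∈p-y (x∈p∧x≢y⇒x∈p-y x∈ x≢v) x≢v′))

      u≢v : u ≢ v
      u≢v refl = irrefl G e
      u′≢v′ : u′ ≢ v′
      u′≢v′ refl = irrefl G e′

      cov : Cover S (S - v - v′) p
      cov .sources = proj₁ ∘ x∈p-y⁻ ∘ proj₁ ∘ x∈p-y⁻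
      cov .pred-∈ x∈ x∉ with split x∈ x∉
      ... | inj₁ refl = subst (_∈ S) (sym pv) u∈
      ... | inj₂ refl = subst (_∈ S) (sym pv′) u′∈
      cov .pred-edge x∈ x∉ with split x∈ x∉
      ... | inj₁ refl = subst (λ y → E G y v) (sym pv) e
      ... | inj₂ refl = subst (λ y → E G y v′) (sym pv′) e′
      cov .pred-inj x∈ x∉ y∈ y∉ eq with split x∈ x∉ | split y∈ y∉
      ... | inj₁ refl | inj₁ refl = refl
      ... | inj₁ refl | inj₂ refl = contradiction (trans (sym pv) (trans eq pv′)) u≢u′
      ... | inj₂ refl | inj₁ refl = contradiction (trans (sym pv) (trans (sym eq) pv′)) u≢u′
      ... | inj₂ refl | inj₂ refl = refl
      cov .no-2-cycle {x} x∈ x∉ px∉ eq with split x∈ x∉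
      ... | inj₁ refl = px∉ (subst (_∈ S - v - v′) (sym pv) (x∈p∧x≢y⇒x∈p-y (x∈p∧x≢y⇒x∈p-y u∈ u≢v) u≢v′))
      ... | inj₂ refl with split u′∈ (subst (_∉ S - v - v′) pv′ px∉)
      ...   | inj₁ refl = u≢v′ (trans (sym pv) (trans (cong p (sym pv′)) eq))
      ...   | inj₂ u′≡v′ = u′≢v′ u′≡v′

      ext : u′ ≢ v ⊎ (∀ w → E G v w → w ∈ S) → Extendable S (S - v - v′) p
      ext alt {y} {z} y∈ z∉ yz with y ≟ v | y ≟ v′ | alt
      ... | no y≢v | no y≢v′ | _ = inj₁ (x∈p∧x≢y⇒x∈p-y (x∈p∧x≢y⇒x∈p-y y∈ y≢v) y≢v′)
      ... | _ | yes refl | _ = inj₂ λ x∈ x∉ eq → case split x∈ x∉ of λ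
              { (inj₁ refl) → u≢v′ (trans (sym pv) eq) ; (inj₂ refl) → u′≢v′ (trans (sym pv′) eq) }
      ... | yes refl | no _ | inj₂ closed = contradiction (closed z yz) z∉
      ... | yes refl | no _ | inj₁ u′≢v = inj₂ λ x∈ x∉ eq → case split x∈ x∉ of λ
              { (inj₁ refl) → u≢v (trans (sym pv) eq) ; (inj₂ refl) → u′≢v (trans (sym pv′) eq) }
    ... | A′ , _ , cov′ , eq = A′ , cover⇒forcing cov′ ,
      trans (cong (2 +_) eq) (trans (cong suc (1+∣p-x∣≡∣p∣ (x∈p∧x≢y⇒x∈p-y v′∈ (v≢v′ ∘ sym)))) (1+∣p-x∣≡∣p∣ v∈))

-- The forest of forcing chains.

injective⇒surjective : ∀ {n} (f : Fin n → Fin n) → (∀ {i j} → f i ≡ f j → i ≡ j) → ∀ i → ∃ λ j → f j ≡ i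
injective⇒surjective {suc n} f inj i with any? (λ j → f j ≟ i)
... | yes found = found
... | no ¬found = contradiction
  (injective⇒≤ {f = λ j → punchOut (i≢f j)} (inj ∘ punchOut-injective (i≢f _) (i≢f _))) 1+n≰n
  where
  i≢f : ∀ j → i ≢ f j
  i≢f j i≡fj = ¬found (j , sym i≡fj)

∣p∣≡1⇒p≡⁅x⁆ : ∀ {n} {p : Subset n} {x} → ∣ p ∣ ≡ 1 → x ∈ p → p ≡ ⁅ x ⁆
∣p∣≡1⇒p≡⁅x⁆ {p = p} {x} eq x∈ = ⊆-antisym sub (λ y∈ → subst (_∈ p) (sym (x∈⁅y⁆⇒x≡y x y∈)) x∈)
  where
  sub : p ⊆ ⁅ x ⁆
  sub {y} y∈ = decidable-stable (y ∈? ⁅ x ⁆) λ y∉ → 1+n≰n (subst (2 ≤_) eq (2≤∣p∣ y∈ x∈ (x∉⁅y⁆⇒x≢y y∉)))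

data Depth {n : ℕ} (C : Subset n) (p : Fin n → Fin n) : Fin n → ℕ → Set where
  root  : ∀ {x} → x ∈ C → Depth C p x 0
  child : ∀ {x m} → x ∉ C → Depth C p (p x) m → Depth C p x (suc m)

module _ {n : ℕ} {C : Subset n} {p : Fin n → Fin n} where

  depth-unique : ∀ {x m m′} → Depth C p x m → Depth C p x m′ → m ≡ m′
  depth-unique (root _) (root _) = refl
  depth-unique (root x∈) (child x∉ _) = contradiction x∈ x∉
  depth-unique (child x∉ _) (root x∈) = contradiction x∈ x∉
  depth-unique (child _ d) (child _ d′) = cong suc (depth-unique d d′)

  depth-smaller : ∀ {x m i} → Depth C p x m → i ≤ m → ∃ λ y → Depth C p y i
  depth-smaller {x} d i≤m with m≤n⇒m<n∨m≡n i≤m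
  ... | inj₂ refl = x , d
  depth-smaller (child _ d) _ | inj₁ (s≤s i≤m) = depth-smaller d i≤m

  -- All smaller depths occur among the ancestors of `x`, and vertices of different depths are
  -- distinct.
  depth<n : ∀ {x m} → Depth C p x m → m < n
  depth<n {m = m} d = injective⇒≤ {f = λ i → proj₁ (at i)}
    λ {i} {j} eq → toℕ-injective (depth-unique (proj₂ (at i)) (subst (λ y → Depth C p y (toℕ j)) (sym eq) (proj₂ (at j))))
    where
    at : (i : Fin (suc m)) → ∃ λ y → Depth C p y (toℕ i)
    at i = depth-smaller d (toℕ≤pred[n] i)

module _ {n : ℕ} (G : Graph n) where

  record Forest (C : Subset n) (p : Fin n → Fin n) : Set where
    field
      parent-edge : ∀ {x} → x ∉ C → E G (p x) x
      depth       : ∀ x → ∃ (Depth C p x)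
  open Forest

  -- `p` sends each vertex to the one that forced it. It is injective because after forcing `w` the
  -- vertex `v` has no uncoloured neighbour left and cannot force again.
  forcing⇒forest : ∀ {C} → Star (Force G) C ⊤ → ∃ λ p → Forest C p ×
    (∀ {x y} → x ∉ C → y ∉ C → p x ≡ p y → x ≡ y)
  forcing⇒forest ε = id , record { parent-edge = contradiction ∈⊤ ; depth = λ _ → 0 , root ∈⊤ } , contradiction ∈⊤
  forcing⇒forest {C} (force v w v∈ e w∉ only ◅ fs) with forcing⇒forest fs
  ... | p , f , inj = p′ , f′ , inj′
    where
    p′ : Fin n → Fin n
    p′ = p [ w ↦ v ]

    split : ∀ {x} → x ∉ C → (x ≡ w × p′ x ≡ v) ⊎ (x ∉ C ∪ ⁅ w ⁆ × p′ x ≡ p x)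
    split {x} x∉ with x ≟ w
    ... | yes x≡w = inj₁ (x≡w , refl)
    ... | no x≢w = inj₂ ((λ x∈ → case x∈p∪y⁻ x∈ of λ { (inj₁ x∈C) → x∉ x∈C ; (inj₂ x≡w) → x≢w x≡w }) , refl)

    down : ∀ {x m} → Depth (C ∪ ⁅ w ⁆) p x m → ∃ (Depth C p′ x)
    down (root x∈) with x∈p∪y⁻ x∈
    ... | inj₁ x∈C = _ , root x∈C
    ... | inj₂ refl = _ , child w∉ (root (subst (_∈ C) (sym (update-same p w v)) v∈))
    down {x} (child x∉ d) with down d
    ... | m , d′ = _ , child (x∉ ∘ x∈p⇒x∈p∪y) (subst (λ y → Depth C p′ y m)
            (sym (update-other p w v λ { refl → x∉ (y∈p∪y {p = C}) })) d′)

    f′ : Forest C p′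
    f′ .parent-edge {x} x∉ with split x∉
    ... | inj₁ (refl , eq) = subst (λ y → E G y x) (sym eq) e
    ... | inj₂ (x∉′ , eq) = subst (λ y → E G y x) (sym eq) (parent-edge f x∉′)
    f′ .depth x = down (proj₂ (depth f x))

    not-v : ∀ {y} → y ∉ C ∪ ⁅ w ⁆ → p y ≢ v
    not-v {y} y∉ py≡v = y∉ (subst (_∈ C ∪ ⁅ w ⁆)
      (sym (only y (subst (λ z → E G z y) py≡v (parent-edge f y∉)) (y∉ ∘ x∈p⇒x∈p∪y))) (y∈p∪y {p = C}))

    inj′ : ∀ {x y} → x ∉ C → y ∉ C → p′ x ≡ p′ y → x ≡ y
    inj′ x∉ y∉ eq with split x∉ | split y∉
    ... | inj₁ (refl , _) | inj₁ (refl , _) = refl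
    ... | inj₁ (refl , eqx) | inj₂ (y∉′ , eqy) = contradiction (trans (sym eqy) (trans (sym eq) eqx)) (not-v y∉′)
    ... | inj₂ (x∉′ , eqx) | inj₁ (refl , eqy) = contradiction (trans (sym eqx) (trans eq eqy)) (not-v x∉′)
    ... | inj₂ (x∉′ , eqx) | inj₂ (y∉′ , eqy) = inj x∉′ y∉′ (trans (sym eqx) (trans eq eqy))

  module _ (acyc : Acyclic G) {c : Fin n} {p : Fin n → Fin n} (f : Forest ⁅ c ⁆ p) where

    Link : Fin n → Fin n → Set
    Link a b = (b ∉ ⁅ c ⁆ × p b ≡ a) ⊎ (a ∉ ⁅ c ⁆ × p a ≡ b)

    Link? : ∀ a b → Dec (Link a b)
    Link? a b = (¬? (b ∈? ⁅ c ⁆) ×-dec p b ≟ a) ⊎-dec (¬? (a ∈? ⁅ c ⁆) ×-dec p a ≟ b)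

    Link⊆E : ∀ {a b} → Link a b → E G a b
    Link⊆E (inj₁ (b∉ , refl)) = parent-edge f b∉
    Link⊆E (inj₂ (a∉ , refl)) = E-sym G (parent-edge f a∉)

    to-root : ∀ {x m} → Depth ⁅ c ⁆ p x m → Star Link x c
    to-root (root x∈) with x∈⁅y⁆⇒x≡y c x∈
    ... | refl = ε
    to-root (child x∉ d) = inj₂ (x∉ , refl) ◅ to-root d

    -- The walk from `x` up to the root and down to `y` consists of links, so the edge itself is a
    -- link, being a bridge.
    E⇒Link : ∀ {x y} → E G x y → Link x y
    E⇒Link {x} {y} e = decidable-stable (Link? x y)
      (acyc Link Link⊆E e (to-root (proj₂ (depth f x)) ◅◅ reverse swap (to-root (proj₂ (depth f y)))))

  -- Degree at most two away from `c`, put as a pigeonhole statement on three neighbours. Paths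
  -- qualify with any `c`; `Branches c` singles out the spiders with at least three legs.
  Spider : Fin n → Set
  Spider c = ∀ {v} → v ≢ c → ∀ {a b d} → E G v a → E G v b → E G v d → a ≡ b ⊎ b ≡ d ⊎ a ≡ d

  Branches : Fin n → Set
  Branches c = ∃ λ a → ∃ λ b → ∃ λ d → E G c a × E G c b × E G c d × a ≢ b × b ≢ d × a ≢ d

  -- Every neighbour of `v` is its predecessor or one of its successors, and away from `c` there is
  -- at most one successor.
  forest⇒spider : Acyclic G → ∀ {c p} → Forest ⁅ c ⁆ p →
    (∀ {x y} → x ∉ ⁅ c ⁆ → y ∉ ⁅ c ⁆ → p x ≢ c → p x ≡ p y → x ≡ y) → Spider c
  forest⇒spider acyc f inj {v} v≢c va vb vd
    with E⇒Link acyc f va | E⇒Link acyc f vb | E⇒Link acyc f vd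
  ... | inj₁ (a∉ , pa) | inj₁ (b∉ , pb) | _ = inj₁ (inj a∉ b∉ (v≢c ∘ trans (sym pa)) (trans pa (sym pb)))
  ... | inj₁ (a∉ , pa) | inj₂ _ | inj₁ (d∉ , pd) = inj₂ (inj₂ (inj a∉ d∉ (v≢c ∘ trans (sym pa)) (trans pa (sym pd))))
  ... | inj₂ _ | inj₁ (b∉ , pb) | inj₁ (d∉ , pd) = inj₂ (inj₁ (inj b∉ d∉ (v≢c ∘ trans (sym pb)) (trans pb (sym pd))))
  ... | inj₂ (_ , pv) | inj₂ (_ , pv′) | _ = inj₁ (trans (sym pv) pv′)
  ... | inj₂ (_ , pv) | inj₁ _ | inj₂ (_ , pv′) = inj₂ (inj₂ (trans (sym pv) pv′))
  ... | inj₁ _ | inj₂ (_ , pv) | inj₂ (_ , pv′) = inj₂ (inj₁ (trans (sym pv) pv′))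

  -- With a single root and an injective `p` there is one vertex at each depth, so depth numbers the
  -- vertices along a path.
  forcing-vertex⇒path : Acyclic G → ∀ {c} → ForcingSet G ⁅ c ⁆ → Iso G (PathGraph n)
  forcing-vertex⇒path acyc {c} fs with forcing⇒forest fs
  ... | p , f , inj = record
    { to = to ; from = λ i → proj₁ (onto i)
    ; from-to = λ u → to-inj (proj₂ (onto (to u)))
    ; to-from = λ i → proj₂ (onto i)
    ; adj = λ u v → mk⇔ (adj⇒ ∘ E⇒Link acyc f) adj⇐ }
    where
    d : ∀ x → Depth ⁅ c ⁆ p x (proj₁ (depth f x))
    d x = proj₂ (depth f x)

    to : Fin n → Fin n
    to x = fromℕ< (depth<n (d x))

    toℕ-to : ∀ x → toℕ (to x) ≡ proj₁ (depth f x)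
    toℕ-to x = toℕ-fromℕ< (depth<n (d x))

    depth-inj : ∀ {x y m} → Depth ⁅ c ⁆ p x m → Depth ⁅ c ⁆ p y m → x ≡ y
    depth-inj (root x∈) (root y∈) = trans (x∈⁅y⁆⇒x≡y c x∈) (sym (x∈⁅y⁆⇒x≡y c y∈))
    depth-inj (child x∉ dx) (child y∉ dy) = inj x∉ y∉ (depth-inj dx dy)

    to-inj : ∀ {x y} → to x ≡ to y → x ≡ y
    to-inj {x} {y} eq = depth-inj (d x) (subst (Depth ⁅ c ⁆ p y)
      (trans (sym (toℕ-to y)) (trans (cong toℕ (sym eq)) (toℕ-to x))) (d y))

    onto : ∀ i → ∃ λ x → to x ≡ i
    onto = injective⇒surjective to to-inj

    next : ∀ {u v} → v ∉ ⁅ c ⁆ → p v ≡ u → suc (toℕ (to u)) ≡ toℕ (to v)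
    next {u} {v} v∉ refl = trans (cong suc (toℕ-to u)) (trans (depth-unique (child v∉ (d u)) (d v)) (sym (toℕ-to v)))

    adj⇒ : ∀ {u v} → Link acyc f u v → E (PathGraph n) (to u) (to v)
    adj⇒ (inj₁ (v∉ , pv)) = inj₁ (next v∉ pv)
    adj⇒ (inj₂ (u∉ , pu)) = inj₂ (next u∉ pu)

    edge : ∀ {u v} → suc (toℕ (to u)) ≡ toℕ (to v) → E G u v
    edge {u} {v} eq with subst (Depth ⁅ c ⁆ p v) (trans (sym (toℕ-to v)) (trans (sym eq) (cong suc (toℕ-to u)))) (d v)
    ... | child v∉ dpv with depth-inj dpv (d u)
    ...   | refl = parent-edge f v∉

    adj⇐ : ∀ {u v} → E (PathGraph n) (to u) (to v) → E G u v
    adj⇐ (inj₁ eq) = edge eq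
    adj⇐ (inj₂ eq) = E-sym G (edge eq)

  -- Equality forces a path or a spider.

  module _ (¬cyc : ¬ Cycle G) {S : Subset n} {k : ℕ} (fs : ForcingSet G S)
           (total : ∀ v → v ∈ S → ∃ λ u → u ∈ S × E G v u) (size : ∣ S ∣ ≡ suc k)
           (minimal : ∀ A → ForcingSet G A → k ≤ ∣ A ∣) where

    private
      acyc : Acyclic G
      acyc = acyclic G ¬cyc

      no-join : ¬ (∃ λ A → ForcingSet G A × suc (suc ∣ A ∣) ≡ ∣ S ∣)
      no-join (A , fA , eq) = 1+n≰n (≤-trans (≤-reflexive (suc-injective (trans eq size))) (minimal A fA))

      no-disjoint-edges : ∀ {u v u′ v′} → u ∈ S → v ∈ S → E G u v → u′ ∈ S → v′ ∈ S → E G u′ v′ →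
        u ≢ u′ → u ≢ v′ → v ≢ u′ → v ≢ v′ → ⊥
      no-disjoint-edges u∈ v∈ e u′∈ v′∈ e′ u≢u′ u≢v′ v≢u′ v≢v′ =
        no-join (join-edges G ¬cyc fs u∈ v∈ e u′∈ v′∈ e′ u≢u′ v≢v′ u≢v′ (inj₁ (v≢u′ ∘ sym)))

    module _ {c l l′ : Fin n} (c∈ : c ∈ S) (l∈ : l ∈ S) (l′∈ : l′ ∈ S)
             (cl : E G c l) (cl′ : E G c l′) (l≢l′ : l ≢ l′) where

      private
        ≢c : ∀ {x} → E G c x → x ≢ c
        ≢c e refl = irrefl G e

      -- Otherwise an edge of `G[S]` at `z` avoids `c` and at least one of `l`, `l′`, and is
      -- disjoint from the corresponding edge at `c`.
      centre-adjacent : ∀ {z} → z ∈ S → z ≢ c → E G c z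
      centre-adjacent {z} z∈ z≢c with z ≟ l | z ≟ l′ | total z z∈
      ... | yes refl | _ | _ = cl
      ... | no _ | yes refl | _ = cl′
      ... | no z≢l | no z≢l′ | z′ , z′∈ , e with z′ ≟ c | z′ ≟ l
      ...   | yes refl | _ = E-sym G e
      ...   | no z′≢c | no z′≢l = ⊥-elim (no-disjoint-edges z∈ z′∈ e c∈ l∈ cl z≢c z≢l z′≢c z′≢l)
      ...   | no z′≢c | yes refl = ⊥-elim (no-disjoint-edges z∈ z′∈ e c∈ l′∈ cl′ z≢c z≢l′ z′≢c l≢l′)

      star⇒spider : Spider c × Branches c
      star⇒spider with any? (λ w → E? G c w ×-dec ¬? (w ∈? S))
      ... | no closed = ⊥-elim (no-join (join-edges G ¬cyc fs l∈ c∈ (E-sym G cl) c∈ l′∈ cl′ (≢c cl) (≢c cl′ ∘ sym) l≢l′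
                          (inj₂ λ w e → decidable-stable (w ∈? S) λ w∉ → closed (w , e , w∉))))
      ... | yes (w , cw , w∉) with forcing⇒forest fs
      ...   | p , f , inj = forest⇒spider acyc f′ inj′ ,
                l , l′ , w , cl , cl′ , cw , l≢l′ , ∈∉⇒≢ l′∈ w∉ , ∈∉⇒≢ l∈ w∉
        where
        p′ : Fin n → Fin n
        p′ x with x ∈? S
        ... | yes _ = c
        ... | no _ = p x

        split : ∀ x → (x ∈ S × p′ x ≡ c) ⊎ (x ∉ S × p′ x ≡ p x)
        split x with x ∈? S
        ... | yes x∈ = inj₁ (x∈ , refl)
        ... | no x∉ = inj₂ (x∉ , refl)

        down : ∀ {x m} → Depth S p x m → ∃ (Depth ⁅ c ⁆ p′ x)
        down {x} _ with x ∈? ⁅ c ⁆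
        down _ | yes x∈c = _ , root x∈c
        down {x} (root x∈) | no x∉c with split x
        ... | inj₁ (_ , eq) = _ , child x∉c (root (subst (_∈ ⁅ c ⁆) (sym eq) (x∈⁅x⁆ c)))
        ... | inj₂ (x∉ , _) = contradiction x∈ x∉
        down {x} (child x∉ d) | no x∉c with split x
        ... | inj₁ (x∈ , _) = contradiction x∈ x∉
        ... | inj₂ (_ , eq) with down d
        ...   | m , d′ = _ , child x∉c (subst (λ y → Depth ⁅ c ⁆ p′ y m) (sym eq) d′)

        f′ : Forest ⁅ c ⁆ p′
        f′ .parent-edge {x} x∉c with split x
        ... | inj₁ (x∈ , eq) = subst (λ y → E G y x) (sym eq) (centre-adjacent x∈ (x∉⁅y⁆⇒x≢y x∉c))
        ... | inj₂ (x∉ , eq) = subst (λ y → E G y x) (sym eq) (parent-edge f x∉)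
        f′ .depth x = down (proj₂ (depth f x))

        inj′ : ∀ {x y} → x ∉ ⁅ c ⁆ → y ∉ ⁅ c ⁆ → p′ x ≢ c → p′ x ≡ p′ y → x ≡ y
        inj′ {x} {y} _ _ px≢c eq with split x | split y
        ... | inj₁ (_ , px≡c) | _ = contradiction px≡c px≢c
        ... | inj₂ _ | inj₁ (_ , py≡c) = contradiction (trans eq py≡c) px≢c
        ... | inj₂ (x∉ , eqx) | inj₂ (y∉ , eqy) = inj x∉ y∉ (trans (sym eqx) (trans eq eqy))

    -- The edge at a third member `w` of `S` must meet the edge `uv`, and the common vertex is the
    -- centre of a star. Without a third member `k` is at most one, so a single vertex forces.
    path-or-spider : 1 ≤ n → (∃ λ S₀ → ForcingSet G S₀ × ∣ S₀ ∣ ≡ k) →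
      Iso G (PathGraph n) ⊎ (∃ λ c → Spider c × Branches c)
    path-or-spider 1≤n (S₀ , fs₀ , size₀) with forcing-nonempty G 1≤n fs
    ... | u , u∈ with total u u∈
    ...   | v , v∈ , e with any? (λ w → w ∈? S ×-dec ¬? (w ≟ u) ×-dec ¬? (w ≟ v))
    ...     | yes (w , w∈ , w≢u , w≢v) with total w w∈
    ...       | w′ , w′∈ , e′ with w′ ≟ u | w′ ≟ v
    ...         | yes refl | _ = inj₂ (u , star⇒spider u∈ v∈ w∈ e (E-sym G e′) (w≢v ∘ sym))
    ...         | no _ | yes refl = inj₂ (v , star⇒spider v∈ u∈ w∈ (E-sym G e) (E-sym G e′) (w≢u ∘ sym))
    ...         | no w′≢u | no w′≢v = ⊥-elim (no-disjoint-edges w∈ w′∈ e′ u∈ v∈ e w≢u w≢v w′≢u w′≢v)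
    path-or-spider 1≤n (S₀ , fs₀ , size₀) | u , u∈ | v , v∈ , e | no none with forcing-nonempty G 1≤n fs₀
    ... | x , x∈ = inj₁ (forcing-vertex⇒path acyc (subst (ForcingSet G) (∣p∣≡1⇒p≡⁅x⁆ size₀≡1 x∈) fs₀))
      where
      S⊆ : S ⊆ ⁅ u ⁆ ∪ ⁅ v ⁆
      S⊆ {w} w∈ with w ≟ u | w ≟ v
      ... | yes refl | _ = x∈p⇒x∈p∪y (x∈⁅x⁆ u)
      ... | no _ | yes refl = y∈p∪y {p = ⁅ u ⁆}
      ... | no w≢u | no w≢v = ⊥-elim (none (w , w∈ , w≢u , w≢v))

      k≤1 : k ≤ 1
      k≤1 = ≤-pred (subst (_≤ 2) size (≤-trans (p⊆q⇒∣p∣≤∣q∣ S⊆)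
              (≤-trans (∣p∪⁅y⁆∣≤1+∣p∣ ⁅ u ⁆ v) (≤-reflexive (cong suc (∣⁅x⁆∣≡1 u))))))

      size₀≡1 : ∣ S₀ ∣ ≡ 1
      size₀≡1 = ≤-antisym (subst (_≤ 1) (sym size₀) k≤1) (subst (1 ≤_) (1+∣p-x∣≡∣p∣ x∈) (s≤s z≤n))

-- Contraction, trimming and spiders.

module _ {n : ℕ} (G : Graph n) where

  ≢-edge : ∀ {u v} → E G u v → u ≢ v
  ≢-edge e refl = irrefl G e

  no-triangle : Acyclic G → ∀ {x y z} → E G x y → E G y z → ¬ E G x z
  no-triangle acyc {x} {y} {z} xy yz xz = acyc R R⊆E xz (inj₁ (refl , refl) ◅ inj₂ (refl , refl) ◅ ε) λ
    { (inj₁ (_ , refl)) → irrefl G yz ; (inj₂ (refl , _)) → irrefl G xy }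
    where
    R : Fin n → Fin n → Set
    R a b = (a ≡ x × b ≡ y) ⊎ (a ≡ y × b ≡ z)
    R⊆E : ∀ {a b} → R a b → E G a b
    R⊆E (inj₁ (refl , refl)) = xy
    R⊆E (inj₂ (refl , refl)) = yz

  Linkage : Set
  Linkage = ∀ u v → Star (E G) u v

  deg≤2⇒ : ∀ {v} → deg G v ≤ 2 → ∀ {a b d} → E G v a → E G v b → E G v d → a ≡ b ⊎ b ≡ d ⊎ a ≡ d
  deg≤2⇒ ≤2 va vb vd = ∣p∣≤2⇒ ≤2 (E⇒∈N G va) (E⇒∈N G vb) (E⇒∈N G vd)

  spider⇒deg≤2 : ∀ {c} → Spider G c → ∀ {v} → v ≢ c → deg G v ≤ 2
  spider⇒deg≤2 sp {v} v≢c = ∣p∣≤2 (N G v) λ a∈ b∈ d∈ → sp v≢c (∈N⇒E G a∈) (∈N⇒E G b∈) (∈N⇒E G d∈)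

  branches⇒2<deg : ∀ {c} → Branches G c → 2 < deg G c
  branches⇒2<deg (a , b , d , ca , cb , cd , a≢b , b≢d , a≢d) = ≰⇒> λ ≤2 → case deg≤2⇒ ≤2 ca cb cd of λ
    { (inj₁ a≡b) → a≢b a≡b ; (inj₂ (inj₁ b≡d)) → b≢d b≡d ; (inj₂ (inj₂ a≡d)) → a≢d a≡d }

  eligible? : ∀ x y → Dec (Eligible G x y)
  eligible? x y = E? G x y ×-dec deg G x ℕ.≟ 2 ×-dec deg G y ℕ.≤? 2

module _ {m : ℕ} {G : Graph (suc m)} {x y : Fin (suc m)} {G′ : Graph m} (xy : E G x y) (con : Contraction G x y G′) where

  open Contraction con

  merge⁻ : ∀ {u v} → f u ≡ f v → u ≡ v ⊎ (u ≡ x × v ≡ y) ⊎ (u ≡ y × v ≡ x)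
  merge⁻ = Equivalence.to (merge _ _)

  merged-edge : ∀ {u v} → (u ≡ x × v ≡ y) ⊎ (u ≡ y × v ≡ x) → E G u v
  merged-edge (inj₁ (refl , refl)) = xy
  merged-edge (inj₂ (refl , refl)) = E-sym G xy

  edge-image : ∀ {u v} → f u ≢ f v → E G u v → E G′ (f u) (f v)
  edge-image ne e = Equivalence.from (adj _ _ ne) (_ , _ , refl , refl , e)

  edge-lift : ∀ {a b} → E G′ a b → ∃₂ λ u v → f u ≡ a × f v ≡ b × E G u v
  edge-lift e = Equivalence.to (adj _ _ (≢-edge G′ e)) e

  image-≢ : ∀ {u v} → u ≢ v → u ≢ x → u ≢ y → f u ≢ f v
  image-≢ u≢v u≢x u≢y eq with merge⁻ eq
  ... | inj₁ u≡v = u≢v u≡v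
  ... | inj₂ (inj₁ (u≡x , _)) = u≢x u≡x
  ... | inj₂ (inj₂ (u≡y , _)) = u≢y u≡y

  linkage-down : Linkage G → Linkage G′
  linkage-down link a b with surj a | surj b
  ... | u , refl | v , refl = go (link u v)
    where
    go : ∀ {u v} → Star (E G) u v → Star (E G′) (f u) (f v)
    go ε = ε
    go {u} {v} (_◅_ {j = w} e es) with f u ≟ f w
    ... | yes eq = subst (λ z → Star (E G′) z (f v)) (sym eq) (go es)
    ... | no ne = edge-image ne e ◅ go es

  -- A walk in the contraction lifts to `G` once the contracted edge is inserted wherever
  -- consecutive lifts do not meet; `R₀` admits that edge and the lifts of `R`.
  acyclic-down : Acyclic G → Acyclic G′
  acyclic-down acyc R R⊆E e rs ¬r with edge-lift e
  ... | u , v , refl , refl , uv = acyc R₀ proj₁ uv (lift rs refl refl) λ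
    { (_ , inj₁ eq) → ≢-edge G′ e eq ; (_ , inj₂ r) → ¬r r }
    where
    R₀ : Fin (suc m) → Fin (suc m) → Set
    R₀ s t = E G s t × (f s ≡ f t ⊎ R (f s) (f t))

    fibre : ∀ {s t} → f s ≡ f t → Star R₀ s t
    fibre eq with merge⁻ eq
    ... | inj₁ refl = ε
    ... | inj₂ pair = (merged-edge pair , inj₁ eq) ◅ ε

    lift : ∀ {a b} → Star R a b → ∀ {s t} → f s ≡ a → f t ≡ b → Star R₀ s t
    lift ε refl eq = fibre (sym eq)
    lift (r ◅ rs) refl ft≡b with edge-lift (R⊆E r)
    ... | s′ , t′ , eqs , eqt , e′ = fibre (sym eqs) ◅◅
      (e′ , inj₂ (subst₂ R (sym eqs) (sym eqt) r)) ◅ lift rs eqt ft≡b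

  module _ (acyc : Acyclic G) where

    -- Distinct neighbours with one image would be `x` and `y`, which form a triangle with `v`.
    neighbours-≢ : ∀ {v a b} → E G v a → E G v b → a ≢ b → f a ≢ f b
    neighbours-≢ va vb a≢b eq with merge⁻ eq
    ... | inj₁ a≡b = a≢b a≡b
    ... | inj₂ pair = no-triangle G acyc va (merged-edge pair) vb

    branches-down : ∀ {c} → c ≢ x → c ≢ y → Branches G c → Branches G′ (f c)
    branches-down {c} c≢x c≢y (a , b , d , ca , cb , cd , a≢b , b≢d , a≢d) =
      f a , f b , f d , image ca , image cb , image cd ,
      neighbours-≢ ca cb a≢b , neighbours-≢ cb cd b≢d , neighbours-≢ ca cd a≢d
      where
      image : ∀ {z} → E G c z → E G′ (f c) (f z)
      image e = edge-image (image-≢ (≢-edge G e) c≢x c≢y) e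

    -- The two merged vertices satisfy the degree bound by assumption; any other vertex has its
    -- neighbours mapped injectively.
    spider-up : deg G x ≤ 2 → deg G y ≤ 2 → ∀ {c′} → Spider G′ c′ → ∃ (Spider G)
    spider-up dx dy {c′} sp′ with surj c′
    ... | c , refl = c , sp
      where
      sp : Spider G c
      sp {v} v≢c va vb vd with v ≟ x | v ≟ y
      ... | yes refl | _ = deg≤2⇒ G dx va vb vd
      ... | no _ | yes refl = deg≤2⇒ G dy va vb vd
      ... | no v≢x | no v≢y with sp′ (image-≢ v≢c v≢x v≢y) (image va) (image vb) (image vd)
        where
        image : ∀ {z} → E G v z → E G′ (f v) (f z)
        image e = edge-image (image-≢ (≢-edge G e) v≢x v≢y) e
      ...   | inj₁ eq = inj₁ (decidable-stable (_ ≟ _) λ ne → neighbours-≢ va vb ne eq)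
      ...   | inj₂ (inj₁ eq) = inj₂ (inj₁ (decidable-stable (_ ≟ _) λ ne → neighbours-≢ vb vd ne eq))
      ...   | inj₂ (inj₂ eq) = inj₂ (inj₂ (decidable-stable (_ ≟ _) λ ne → neighbours-≢ va vd ne eq))

    -- One of the at most two neighbours of u is the vertex w it is merged with.
    partner-occupies : ∀ {c} → Spider G c → ∀ {u a b w z} → f u ≡ z → z ≢ f c → E G u a → E G u b → E G u w → f w ≡ z →
      E G′ z (f a) → E G′ z (f b) → f a ≡ f b
    partner-occupies sp refl u≢c ua ub uw fw ea eb with sp (u≢c ∘ cong f) ua ub uw
    ... | inj₁ a≡b = cong f a≡b
    ... | inj₂ (inj₁ refl) = contradiction (sym fw) (≢-edge G′ eb)
    ... | inj₂ (inj₂ refl) = contradiction (sym fw) (≢-edge G′ ea)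

    -- Three edges at a vertex of the contraction lift either to edges at one vertex of `G`, or two
    -- of them to one vertex of the merged pair and the third to its partner. In the latter case
    -- those two have the same image.
    spider-down : ∀ {c} → Spider G c → Spider G′ (f c)
    spider-down {c} sp {v′} v′≢fc va vb vd with edge-lift va | edge-lift vb | edge-lift vd
    ... | u₁ , a , refl , refl , e₁ | u₂ , b , eq₂ , refl , e₂ | u₃ , d , eq₃ , refl , e₃
      with merge⁻ (sym eq₂) | merge⁻ (sym eq₃)
    ... | inj₁ refl | inj₁ refl = Sum.map (cong f) (Sum.map (cong f) (cong f)) (sp (v′≢fc ∘ cong f) e₁ e₂ e₃)
    ... | inj₁ refl | inj₂ pair = inj₁ (partner-occupies sp refl v′≢fc e₁ e₂ (merged-edge pair) eq₃ va vb)
    ... | inj₂ pair | inj₁ refl = inj₂ (inj₂ (partner-occupies sp refl v′≢fc e₁ e₃ (merged-edge pair) eq₂ va vd))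
    ... | inj₂ pair | inj₂ pair′ with partner-unique pair pair′
      where
      partner-unique : ∀ {u v w} → (u ≡ x × v ≡ y) ⊎ (u ≡ y × v ≡ x) → (u ≡ x × w ≡ y) ⊎ (u ≡ y × w ≡ x) → v ≡ w
      partner-unique (inj₁ (_ , refl)) (inj₁ (_ , refl)) = refl
      partner-unique (inj₂ (_ , refl)) (inj₂ (_ , refl)) = refl
      partner-unique (inj₁ (refl , _)) (inj₂ (refl , _)) = contradiction xy (irrefl G)
      partner-unique (inj₂ (refl , _)) (inj₁ (refl , _)) = contradiction xy (irrefl G)
    ...   | refl = inj₂ (inj₁ (partner-occupies sp eq₂ v′≢fc e₂ e₃ (E-sym G (merged-edge pair)) refl vb vd))

-- `ρ` sends `y` to `x`, and `punchOut` closes the gap left by `y`. Edges are images of edges, with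
-- `a ≢ b` removing the loop that comes from an edge `xy`.
contract : ∀ {m} (G : Graph (suc m)) {x y} → x ≢ y → ∃ (Contraction G x y)
contract {m} G {x} {y} x≢y = G′ , con
  where
  ρ : Fin (suc m) → Fin (suc m)
  ρ v with v ≟ y
  ... | yes _ = x
  ... | no _ = v

  ρ-cases : ∀ v → (v ≡ y × ρ v ≡ x) ⊎ (v ≢ y × ρ v ≡ v)
  ρ-cases v with v ≟ y
  ... | yes v≡y = inj₁ (v≡y , refl)
  ... | no v≢y = inj₂ (v≢y , refl)

  y≢ρ : ∀ v → y ≢ ρ v
  y≢ρ v y≡ρv with ρ-cases v
  ... | inj₁ (_ , eq) = x≢y (sym (trans y≡ρv eq))
  ... | inj₂ (v≢y , eq) = v≢y (sym (trans y≡ρv eq))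

  f₀ : Fin (suc m) → Fin m
  f₀ v = punchOut (y≢ρ v)

  E′ : Fin m → Fin m → Set
  E′ a b = a ≢ b × ∃₂ λ u v → f₀ u ≡ a × f₀ v ≡ b × E G u v

  G′ : Graph m
  G′ = record
    { E = E′
    ; E? = λ a b → ¬? (a ≟ b) ×-dec any? (λ u → any? (λ v → f₀ u ≟ a ×-dec f₀ v ≟ b ×-dec E? G u v))
    ; E-sym = λ { (a≢b , u , v , fu , fv , e) → a≢b ∘ sym , v , u , fv , fu , E-sym G e }
    ; irrefl = λ { (a≢a , _) → a≢a refl } }

  ρ-merge : ∀ {u v} → ρ u ≡ ρ v → u ≡ v ⊎ (u ≡ x × v ≡ y) ⊎ (u ≡ y × v ≡ x)
  ρ-merge {u} {v} eq with ρ-cases u | ρ-cases v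
  ... | inj₁ (refl , _) | inj₁ (refl , _) = inj₁ refl
  ... | inj₁ (u≡y , eu) | inj₂ (_ , ev) = inj₂ (inj₂ (u≡y , trans (sym ev) (trans (sym eq) eu)))
  ... | inj₂ (_ , eu) | inj₁ (v≡y , ev) = inj₂ (inj₁ (trans (sym eu) (trans eq ev) , v≡y))
  ... | inj₂ (_ , eu) | inj₂ (_ , ev) = inj₁ (trans (sym eu) (trans eq ev))

  ρx≡ρy : ρ x ≡ ρ y
  ρx≡ρy with ρ-cases x | ρ-cases y
  ... | inj₁ (x≡y , _) | _ = contradiction x≡y x≢y
  ... | inj₂ _ | inj₂ (y≢y , _) = contradiction refl y≢y
  ... | inj₂ (_ , ex) | inj₁ (_ , ey) = trans ex (sym ey)

  con : Contraction G x y G′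
  con .Contraction.f = f₀
  con .Contraction.surj a = punchIn y a , trans (punchOut-cong y ρ-punchIn) (punchOut-punchIn y)
    where
    ρ-punchIn : ρ (punchIn y a) ≡ punchIn y a
    ρ-punchIn with ρ-cases (punchIn y a)
    ... | inj₁ (eq , _) = contradiction eq (punchInᵢ≢i y a)
    ... | inj₂ (_ , eq) = eq
  con .Contraction.merge u v = mk⇔ (ρ-merge ∘ punchOut-injective (y≢ρ u) (y≢ρ v)) λ
    { (inj₁ refl) → refl
    ; (inj₂ (inj₁ (refl , refl))) → punchOut-cong y ρx≡ρy
    ; (inj₂ (inj₂ (refl , refl))) → punchOut-cong y (sym ρx≡ρy) }
  con .Contraction.adj a b a≢b = mk⇔ proj₂ (a≢b ,_)

-- Were `z` reached from `c` only through a neighbour `w` of `c`, then `w` would have degree two and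
-- the edge `wz` would be eligible. So `c` is adjacent to all others, and an edge between two of
-- these would close a triangle.
trimmed⇒star : ∀ {m} (G : Graph (suc m)) → Acyclic G → Linkage G → ∀ {c} → Spider G c → Trimmed G → Iso G (StarGraph m)
trimmed⇒star {m} G acyc link {c} sp trimmed = record
  { to = π ⟨$⟩ʳ_ ; from = π ⟨$⟩ˡ_
  ; from-to = λ _ → inverseˡ π ; to-from = λ _ → inverseʳ π
  ; adj = λ u v → mk⇔ adj⇒ adj⇐ }
  where
  π = transpose c zero

  πc≡0 : π ⟨$⟩ʳ c ≡ zero
  πc≡0 rewrite dec-true (c ≟ c) refl = refl

  π≡0⇒c : ∀ {v} → π ⟨$⟩ʳ v ≡ zero → v ≡ c
  π≡0⇒c eq = trans (sym (inverseˡ π)) (trans (cong (π ⟨$⟩ˡ_) (trans eq (sym πc≡0))) (inverseˡ π))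

  hub : ∀ {z} → Star (E G) z c → z ≢ c → E G c z
  hub ε z≢c = contradiction refl z≢c
  hub {z} (_◅_ {j = w} e es) z≢c with w ≟ c
  ... | yes refl = E-sym G e
  ... | no w≢c = ⊥-elim (trimmed w z (E-sym G e ,
          ≤-antisym (spider⇒deg≤2 G sp w≢c) (2≤∣p∣ (E⇒∈N G (E-sym G (hub es w≢c))) (E⇒∈N G (E-sym G e)) (z≢c ∘ sym)) ,
          spider⇒deg≤2 G sp z≢c))

  adj⇒ : ∀ {u v} → E G u v → E (StarGraph m) (π ⟨$⟩ʳ u) (π ⟨$⟩ʳ v)
  adj⇒ {u} {v} e = split (u ≟ c) (v ≟ c)
    where
    split : Dec (u ≡ c) → Dec (v ≡ c) → E (StarGraph m) (π ⟨$⟩ʳ u) (π ⟨$⟩ʳ v)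
    split (yes refl) _ = inj₁ (πc≡0 , λ eq → ≢-edge G e (sym (π≡0⇒c eq)))
    split (no u≢c) (yes refl) = inj₂ (πc≡0 , λ eq → u≢c (π≡0⇒c eq))
    split (no u≢c) (no v≢c) = contradiction (hub (link v c) v≢c) (no-triangle G acyc (hub (link u c) u≢c) e)

  spoke : ∀ {u v} → π ⟨$⟩ʳ u ≡ zero → π ⟨$⟩ʳ v ≢ zero → E G u v
  spoke {u} {v} u≡ v≢ with π≡0⇒c {u} u≡
  ... | refl = hub (link v c) λ { refl → v≢ u≡ }

  adj⇐ : ∀ {u v} → E (StarGraph m) (π ⟨$⟩ʳ u) (π ⟨$⟩ʳ v) → E G u v
  adj⇐ (inj₁ (u≡ , v≢)) = spoke u≡ v≢
  adj⇐ (inj₂ (v≡ , u≢)) = E-sym G (spoke v≡ u≢)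

-- Each contraction lowers the order. It avoids `c`, whose degree exceeds two, so the centre and its
-- three branches survive until nothing is eligible.
spider⇒trims : ∀ {n} (G : Graph n) → Acyclic G → Linkage G → ∀ {c} → Spider G c → Branches G c →
  Σ ℕ λ k → 3 ≤ k × TrimIso G (StarGraph k)
spider⇒trims {suc m} G acyc link {c} sp br with any? (λ x → any? (eligible? G x))
... | no none = m , 3≤m , suc m , G , done , trimmed , trimmed⇒star G acyc link sp trimmed
  where
  trimmed : Trimmed G
  trimmed x y el = none (x , y , el)
  3≤m : 3 ≤ m
  3≤m = ≤-pred (subst (4 ≤_) (trans (1+∣p-x∣≡∣p∣ {x = c} ∈⊤) (∣⊤∣≡n (suc m))) (s≤s (≤-trans (branches⇒2<deg G br)
          (p⊆q⇒∣p∣≤∣q∣ λ v∈ → x∈p∧x≢y⇒x∈p-y ∈⊤ (≢-edge G (∈N⇒E G v∈) ∘ sym)))))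
... | yes (x , y , el@(xy , dx , dy)) with contract G (≢-edge G xy)
...   | G′ , con with spider⇒trims G′ (acyclic-down xy con acyc) (linkage-down xy con link) (spider-down xy con acyc sp)
                        (branches-down xy con acyc (centre≢ (≤-reflexive dx)) (centre≢ dy) br)
  where
  centre≢ : ∀ {v} → deg G v ≤ 2 → c ≢ v
  centre≢ d refl = 1+n≰n (≤-trans (branches⇒2<deg G br) d)
...     | k , 3≤k , _ , T , trims , iso = k , 3≤k , _ , T , step (x , y , el , con) trims , iso

trims⇒spider : ∀ {n m} {G : Graph n} {H : Graph m} → Acyclic G → Trims G H → ∃ (Spider H) → ∃ (Spider G)
trims⇒spider acyc done sp = sp
trims⇒spider acyc (step (x , y , (xy , dx , dy) , con) trims) sp =
  spider-up xy con acyc (≤-reflexive dx) dy (proj₂ (trims⇒spider (acyclic-down xy con acyc) trims sp))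

iso⇒spider : ∀ {n m} {G : Graph n} {H : Graph m} → Iso G H → ∃ (Spider H) → ∃ (Spider G)
iso⇒spider {G = G} {H} iso (c , sp) = from c , λ v≢ va vb vd →
  Sum.map to-inj (Sum.map to-inj to-inj) (sp (λ eq → v≢ (trans (sym (from-to _)) (cong from eq)))
    (Equivalence.to (adj _ _) va) (Equivalence.to (adj _ _) vb) (Equivalence.to (adj _ _) vd))
  where
  open Iso iso
  to-inj : ∀ {u v} → to u ≡ to v → u ≡ v
  to-inj eq = trans (sym (from-to _)) (trans (cong from eq) (from-to _))

star-spider : ∀ k → Spider (StarGraph k) zero
star-spider k v≢0 (inj₁ (v≡0 , _)) _ _ = contradiction v≡0 v≢0
star-spider k v≢0 (inj₂ _) (inj₁ (v≡0 , _)) _ = contradiction v≡0 v≢0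
star-spider k v≢0 (inj₂ (a≡0 , _)) (inj₂ (b≡0 , _)) _ = inj₁ (trans a≡0 (sym b≡0))

path-spider : ∀ {n} c → Spider (PathGraph n) c
path-spider c _ (inj₁ va) (inj₁ vb) _ = inj₁ (toℕ-injective (trans (sym va) vb))
path-spider c _ (inj₁ va) (inj₂ _) (inj₁ vd) = inj₂ (inj₂ (toℕ-injective (trans (sym va) vd)))
path-spider c _ (inj₂ _) (inj₁ vb) (inj₁ vd) = inj₂ (inj₁ (toℕ-injective (trans (sym vb) vd)))
path-spider c _ (inj₂ va) (inj₂ vb) _ = inj₁ (toℕ-injective (suc-injective (trans va (sym vb))))
path-spider c _ (inj₂ va) (inj₁ _) (inj₂ vd) = inj₂ (inj₂ (toℕ-injective (suc-injective (trans va (sym vd)))))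
path-spider c _ (inj₁ _) (inj₂ vb) (inj₂ vd) = inj₂ (inj₁ (toℕ-injective (suc-injective (trans vb (sym vd)))))

-- Paths and trees that trim to a star are brought under one property, for which the upper bound is
-- proved once.
InH⇒spider : ∀ {n} {T : Graph n} → 1 ≤ n → Acyclic T → InH T → ∃ (Spider T)
InH⇒spider {suc n} _ acyc (inj₁ iso) = iso⇒spider iso (zero , path-spider zero)
InH⇒spider _ acyc (inj₂ (k , _ , _ , _ , trims , _ , iso)) =
  trims⇒spider acyc trims (iso⇒spider iso (zero , star-spider k))

-- Forcing numbers and the degree of the centre.

∣p∣≤1+∣p-x∣ : ∀ {n} (p : Subset n) x → ∣ p ∣ ≤ suc ∣ p - x ∣
∣p∣≤1+∣p-x∣ p x with x ∈? p
... | yes x∈ = ≤-reflexive (sym (1+∣p-x∣≡∣p∣ x∈))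
... | no x∉ = ≤-trans (p⊆q⇒∣p∣≤∣q∣ p⊆p-x) (n≤1+n _)
  where
  p⊆p-x : p ⊆ p - x
  p⊆p-x y∈ = x∈p∧x≢y⇒x∈p-y y∈ λ { refl → x∉ y∈ }

module _ {n : ℕ} (G : Graph n) where

  module _ (c : Fin n) where

    -- Walks along this relation from a neighbour of `c` sweep out a branch at `c`, a component of
    -- the graph without `c`.
    EdgeOff : Fin n → Fin n → Set
    EdgeOff s t = E G s t × s ≢ c × t ≢ c

    reverse-off : ∀ {s t} → Star EdgeOff s t → Star EdgeOff t s
    reverse-off = reverse λ { (e , s≢c , t≢c) → E-sym G e , t≢c , s≢c }

    stays-off : ∀ {s t} → s ≢ c → Star EdgeOff s t → t ≢ c
    stays-off s≢c ε = s≢c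
    stays-off _ ((_ , _ , t≢c) ◅ walk) = stays-off t≢c walk

    -- Only c itself can bring colour into a branch at c that has none, and c forces at most once.
    coloured-branches : ∀ {C} → Star (Force G) C ⊤ →
      ∃ λ w → ∀ {a} → E G c a → a ≢ w → ∃ λ v → v ∈ C × Star EdgeOff a v
    -- No neighbour of `c` has to be exempted here, and the value `c` exempts none.
    coloured-branches ε = c , λ {a} _ _ → a , ∈⊤ , ε
    coloured-branches {C} (force v w v∈ e w∉ only ◅ fs) with v ≟ c
    ... | yes refl = w , λ {a} ca a≢w → a , decidable-stable (a ∈? C) (λ a∉ → a≢w (only a ca a∉)) , ε
    ... | no v≢c with coloured-branches fs
    ...   | w₀ , h = w₀ , h′
      where
      h′ : ∀ {a} → E G c a → a ≢ w₀ → ∃ λ v → v ∈ C × Star EdgeOff a v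
      h′ ca a≢w₀ with h ca a≢w₀
      ... | u , u∈ , walk with x∈p∪y⁻ u∈
      ...   | inj₁ u∈C = u , u∈C , walk
      -- If the colour found is that of the new vertex, its forcer `v` lies in the same branch and
      -- was coloured before.
      ...   | inj₂ refl = v , v∈ , walk ◅◅ (E-sym G e , stays-off (≢-edge G ca ∘ sym) walk , v≢c) ◅ ε

    -- Two neighbours of `c` in one branch would give a walk from `c` through `a` to `a′` that does
    -- not use the edge from `c` to `a′`, which is a bridge.
    branch-unique : Acyclic G → ∀ {a a′ v} → E G c a → E G c a′ →
      Star EdgeOff a v → Star EdgeOff a′ v → a ≡ a′
    branch-unique acyc {a} {a′} ca ca′ walk walk′ = decidable-stable (a ≟ a′) λ a≢a′ →
      acyc R R⊆E ca′ (inj₁ (refl , refl) ◅ map inj₂ (walk ◅◅ reverse-off walk′)) λ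
        { (inj₁ (_ , a′≡a)) → a≢a′ (sym a′≡a) ; (inj₂ (_ , c≢c , _)) → c≢c refl }
      where
      R : Fin n → Fin n → Set
      R s t = (s ≡ c × t ≡ a) ⊎ EdgeOff s t
      R⊆E : ∀ {s t} → R s t → E G s t
      R⊆E (inj₁ (refl , refl)) = ca
      R⊆E (inj₂ (e , _)) = e

    -- All branches at `c` except possibly one contain a member of `S`, and distinct branches share
    -- none.
    deg≤1+∣forcing∣ : Acyclic G → ∀ {S} → ForcingSet G S → deg G c ≤ suc ∣ S ∣
    deg≤1+∣forcing∣ acyc {S} fs with coloured-branches fs
    ... | w , h = ≤-trans (∣p∣≤1+∣p-x∣ (N G c) w) (s≤s (∣p∣≤∣q∣-byInjection
      (λ a v → E G c a × Star EdgeOff a v)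
      (λ { (ca , walk) (ca′ , walk′) → branch-unique acyc ca ca′ walk walk′ })
      (N G c - w) S touched))
      where
      touched : ∀ {a} → a ∈ N G c - w → ∃ λ v → v ∈ S × E G c a × Star EdgeOff a v
      touched a∈ with x∈p-y⁻ a∈
      ... | a∈N , a≢w with h (∈N⇒E G a∈N) a≢w
      ...   | v , v∈ , walk = v , v∈ , ∈N⇒E G a∈N , walk

  exit : ∀ {C : Subset n} {u z} → Star (E G) u z → u ∈ C → z ∉ C → ∃₂ λ v w → v ∈ C × w ∉ C × E G v w
  exit ε u∈ z∉ = contradiction u∈ z∉
  exit {C} {u} (_◅_ {j = w} e es) u∈ z∉ with w ∈? C
  ... | yes w∈ = exit es w∈ z∉
  ... | no w∉ = u , w , u∈ , w∉ , e

  module _ (link : Linkage G) {c : Fin n} (sp : Spider G c) {x : Fin n} where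

    -- An invariant that leaves every coloured vertex at most one uncoloured neighbour: for `c` only
    -- `x` is possible, and any other vertex spends one of its at most two neighbours on a coloured
    -- companion. Hence every edge leaving the set is a force.
    record Grown (C : Subset n) : Set where
      field
        centre    : c ∈ C
        spokes    : ∀ {a} → E G c a → a ≢ x → a ∈ C
        companion : ∀ {v} → v ∈ C → v ≢ c → ∃ λ u → u ∈ C × E G v u
    open Grown

    grown⇒forcing : ∀ {S} → Grown S → ForcingSet G S
    grown⇒forcing = progress⇒forcing G Grown next
      where
      next : ∀ {C z} → Grown C → z ∉ C → ∃ λ C′ → Force G C C′ × Grown C′
      next {C} {z} g z∉ with exit (link c z) (centre g) z∉
      ... | v , w , v∈ , w∉ , vw = C ∪ ⁅ w ⁆ , force v w v∈ vw w∉ only , g′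
        where
        only : ∀ w′ → E G v w′ → w′ ∉ C → w′ ≡ w
        only w′ vw′ w′∉ with v ≟ c
        ... | yes refl = trans (is-x vw′ w′∉) (sym (is-x vw w∉))
          where
          is-x : ∀ {a} → E G c a → a ∉ C → a ≡ x
          is-x {a} ca a∉ = decidable-stable (a ≟ x) (a∉ ∘ spokes g ca)
        ... | no v≢c with companion g v∈ v≢c
        ...   | u , u∈ , vu with sp v≢c vu vw vw′
        ...     | inj₁ refl = contradiction u∈ w∉
        ...     | inj₂ (inj₁ w≡w′) = sym w≡w′
        ...     | inj₂ (inj₂ refl) = contradiction u∈ w′∉

        g′ : Grown (C ∪ ⁅ w ⁆)
        g′ .centre = x∈p⇒x∈p∪y (centre g)
        g′ .spokes ca a≢x = x∈p⇒x∈p∪y (spokes g ca a≢x)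
        g′ .companion {a} a∈ a≢c with x∈p∪y⁻ a∈
        ... | inj₂ refl = v , x∈p⇒x∈p∪y v∈ , E-sym G vw
        ... | inj₁ a∈C with companion g a∈C a≢c
        ...   | u , u∈ , au = u , x∈p⇒x∈p∪y u∈ , au

    centre∪spokes-total : ∀ {A y} → A ⊆ N G c → y ∈ A → (∀ {a} → E G c a → a ≢ x → a ∈ A) →
      TotalForcingSet G (A ∪ ⁅ c ⁆)
    centre∪spokes-total {A} {y} A⊆N y∈ all = grown⇒forcing grown , total
      where
      companion′ : ∀ {v} → v ∈ A ∪ ⁅ c ⁆ → v ≢ c → ∃ λ u → u ∈ A ∪ ⁅ c ⁆ × E G v u
      companion′ v∈ v≢c with x∈p∪y⁻ v∈
      ... | inj₁ v∈A = c , y∈p∪y {p = A} , E-sym G (∈N⇒E G (A⊆N v∈A))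
      ... | inj₂ v≡c = contradiction v≡c v≢c

      grown : Grown (A ∪ ⁅ c ⁆)
      grown = record { centre = y∈p∪y {p = A} ; spokes = λ ca a≢x → x∈p⇒x∈p∪y (all ca a≢x) ; companion = companion′ }

      total : ∀ v → v ∈ A ∪ ⁅ c ⁆ → ∃ λ u → u ∈ A ∪ ⁅ c ⁆ × E G v u
      total v v∈ with v ≟ c
      ... | yes refl = y , x∈p⇒x∈p∪y y∈ , ∈N⇒E G (A⊆N y∈)
      ... | no v≢c = companion′ v∈ v≢c

  neighbour : Linkage G → 2 ≤ n → ∀ c → ∃ (E G c)
  neighbour link 2≤n c with exit (link c (proj₁ other)) (x∈⁅x⁆ c) (x≢y⇒x∉⁅y⁆ (proj₂ other))
    where
    other : ∃ λ z → z ≢ c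
    other with 0<∣p∣⇒nonempty {p = ⊤ - c} (≤-pred (subst (2 ≤_) (sym (trans (1+∣p-x∣≡∣p∣ {x = c} ∈⊤) (∣⊤∣≡n n))) 2≤n))
    ... | z , z∈ = z , proj₂ (x∈p-y⁻ {p = ⊤} z∈)
  ... | v , w , v∈ , _ , e with x∈⁅y⁆⇒x≡y c v∈
  ...   | refl = w , e

  -- If `c` has a second neighbour, then `c` and its neighbours other than `x` number `deg G c`,
  -- which is at most one more than the size of any forcing set. If `x` is the only neighbour, it is
  -- kept as the mate of `c`, and the size two suffices because `S` is nonempty.
  spider⇒small-total : 2 ≤ n → Acyclic G → Linkage G → ∀ {c} → Spider G c →
    ∀ {S} → ForcingSet G S → ∃ λ A → TotalForcingSet G A × ∣ A ∣ ≤ suc ∣ S ∣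
  spider⇒small-total 2≤n acyc link {c} sp {S} fs with neighbour link 2≤n c
  ... | x , cx with any? (λ y → ¬? (y ≟ x) ×-dec E? G c y)
  ...   | yes (y , y≢x , cy) = (N G c - x) ∪ ⁅ c ⁆ ,
    centre∪spokes-total link sp (proj₁ ∘ x∈p-y⁻) (x∈p∧x≢y⇒x∈p-y (E⇒∈N G cy) y≢x)
      (λ ca a≢x → x∈p∧x≢y⇒x∈p-y (E⇒∈N G ca) a≢x) ,
    ≤-trans (∣p∪⁅y⁆∣≤1+∣p∣ (N G c - x) c) (subst (_≤ suc ∣ S ∣) (sym (1+∣p-x∣≡∣p∣ (E⇒∈N G cx))) (deg≤1+∣forcing∣ c acyc fs))
  ...   | no none with forcing-nonempty G (≤-trans (n≤1+n 1) 2≤n) fs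
  ...     | v , v∈ = ⁅ x ⁆ ∪ ⁅ c ⁆ ,
    centre∪spokes-total link sp (λ y∈ → subst (_∈ N G c) (sym (x∈⁅y⁆⇒x≡y x y∈)) (E⇒∈N G cx)) (x∈⁅x⁆ x)
      (λ {a} ca a≢x → contradiction (a , a≢x , ca) none) ,
    ≤-trans (∣p∪⁅y⁆∣≤1+∣p∣ ⁅ x ⁆ c) (s≤s (subst (_≤ ∣ S ∣) (sym (∣⁅x⁆∣≡1 x)) (subst (1 ≤_) (1+∣p-x∣≡∣p∣ v∈) (s≤s z≤n))))

-- The inequality and its case of equality.

connected⇒linkage : ∀ {n} {G : Graph n} → Connected G → Linkage G
connected⇒linkage {G = G} conn u v = go (conn u v)
  where
  go : ∀ {u v} → Walk G u v → Star (E G) u v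
  go [] = ε
  go (e ∷ w) = e ◅ go w

theorem5 : {n : ℕ} (T : Graph n) → 2 ≤ n → IsTree T →
    (k kt : ℕ) → IsF T k → IsFt T kt →
    suc k ≤ kt × (kt ≡ suc k ⇔ InH T)
theorem5 {n} T 2≤n (conn , ¬cyc) k kt (witness@(S₀ , fs₀ , size₀) , minimal) ((S , total@(fs , mate) , size) , minimal-t) =
  lower , mk⇔ tight⇒H λ h → ≤-antisym (upper h) lower
  where
  link : Linkage T
  link = connected⇒linkage conn

  acyc : Acyclic T
  acyc = acyclic T ¬cyc

  1≤n : 1 ≤ n
  1≤n = ≤-trans (n≤1+n 1) 2≤n

  lower : suc k ≤ kt
  lower with forcing-nonempty T 1≤n fs
  ... | u , u∈ with mate u u∈
  ...   | v , v∈ , e with join-edge T ¬cyc fs u∈ v∈ e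
  ...     | A , fA , eq = subst (suc k ≤_) (trans eq size) (s≤s (minimal A fA))

  upper : InH T → kt ≤ suc k
  upper h with spider⇒small-total T 2≤n acyc link (proj₂ (InH⇒spider 1≤n acyc h)) fs₀
  ... | A , total-A , le = ≤-trans (minimal-t A total-A) (subst (λ j → ∣ A ∣ ≤ suc j) size₀ le)

  tight⇒H : kt ≡ suc k → InH T
  tight⇒H eq with path-or-spider T ¬cyc fs mate (trans size eq) minimal 1≤n witness
  ... | inj₁ iso = inj₁ iso
  ... | inj₂ (c , sp , br) = inj₂ (spider⇒trims T acyc link sp br)
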